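{- Let $n$ be a positive integer and let $a_0,a_j,b_j\in\mathbb{N}_0$, $c_j\in\mathbb{N}$ with $c_j\ge3$ for all $j\ge1$. Then $H_n^\star[\mathbf{s}]=\sum_{(\mathbf{p};\tilde{\mathbf{p}};\tilde{\tilde{\mathbf{p}}})\in\Pi(\mathbf{s})}\mathcal{H}_n[\mathbf{p};\tilde{\mathbf{p}};\tilde{\tilde{\mathbf{p}}}]$ in each of the following two cases. (A) $\ell\in\mathbb{N}$, $\mathbf{s}=(\{2\}^{b_1},c_1,\{2\}^{a_1},1,\dots,\{2\}^{b_\ell},c_\ell,\{2\}^{a_\ell},1)$, and $\Pi(\mathbf{s})=\{\overline{2b_1+2}\circ1^{\circ(c_1-3)}\circ\overline{2a_1+2}\circ\cdots\circ\overline{2b_\ell+2}\circ1^{\circ(c_\ell-3)}\circ\overline{2a_\ell+2};\ (b_1+1)\circ0^{\circ(c_1-3)}\circ(a_1+1)\circ\cdots\circ(b_\ell+1)\circ0^{\circ(c_\ell-3)}\circ(a_\ell+1);\ 1\circ\theta^{\circ(c_1-3)}\circ1\circ\big((-1)\circ\theta^{\circ(c_2-3)}\circ1\big)\circ\cdots\circ\big((-1)\circ\theta^{\circ(c_\ell-3)}\circ1\big)\}$, i.e. the third string is $1,\theta^{c_1-3},1$ followed, for each $j=2,\dots,\ell$, by the block $-1,\theta^{c_j-3},1$ (no such blocks if $\ell=1$). (B) $\ell\in\mathbb{N}_0$, $\mathbf{s}=(\{2\}^{a_0},1,\{2\}^{b_1},c_1,\{2\}^{a_1},1,\dots,\{2\}^{b_\ell},c_\ell,\{2\}^{a_\ell},1)$,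 and $\Pi(\mathbf{s})=\{(2a_0+1)\circ\overline{2b_1+2}\circ1^{\circ(c_1-3)}\circ\overline{2a_1+2}\circ\cdots\circ\overline{2b_\ell+2}\circ1^{\circ(c_\ell-3)}\circ\overline{2a_\ell+2};\ (a_0+1)\circ(b_1+1)\circ0^{\circ(c_1-3)}\circ(a_1+1)\circ\cdots\circ(b_\ell+1)\circ0^{\circ(c_\ell-3)}\circ(a_\ell+1);\ 2\circ\big((-1)\circ\theta^{\circ(c_1-3)}\circ1\big)\circ\cdots\circ\big((-1)\circ\theta^{\circ(c_\ell-3)}\circ1\big)\}$, i.e. the third string is $2$ followed, for each $j=1,\dots,\ell$, by the block $-1,\theta^{c_j-3},1$.
   Context: Fix $0<q<1$. $[k]=(1-q^k)/(1-q)$; $(x;q)_n=\prod_{i=0}^{n-1}(1-xq^i)$; $\binom{n}{k}_q=(q;q)_n/((q;q)_k(q;q)_{n-k})$ for $0\le k\le n$, else $0$. $\{x\}^a$ denotes $a$ copies of $x$. Signed numbers: $\mathbb{D}_0=\mathbb{N}_0\cup\{\bar k:k\in\mathbb{N}_0\}$ ($\bar k$ a formal symbol), $|k|=|\bar k|=k$, $\operatorname{sgn}(k)=1$, $\operatorname{sgn}(\bar k)=-1$; $a\oplus b=\overline{|a|+|b|}$ if exactly one of $a,b$ is unbarred, $a+b$ if both unbarred, $|a|+|b|$ if both barred. For $\mathbf{s}\in\mathbb{D}_0^m$: $H_n^\star[\mathbf{s}]=\sum_{n\ge k_1\ge\cdots\ge k_m\ge1}\prod_{j}\operatorname{sgn}(s_j)^{k_j}q^{k_j}/[k_j]^{|s_j|}$.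 $\theta$ is a formal symbol; $Q(r,k)=rk(k-1)/2$ if $r\in\mathbb{Z},r>0$; $Q(r,k)=rk(k-1)/2-k$ if $r\in\mathbb{Z},r\le0$; $Q(\theta,k)=0$. On $\mathbb{Z}\cup\{\theta\}$: $\theta\boxplus a=a\boxplus\theta=a$; $a\boxplus b=a+b$ for integers with $(a,b)\neq(1,-1),(-1,1)$; $1\boxplus(-1)=\theta$, $(-1)\boxplus1=0$; iterated $\boxplus$ evaluated left to right. For $\mathbf{s}\in\mathbb{D}_0^m$, $\mathbf{t}\in\mathbb{N}_0^m$, $\mathbf{r}\in(\mathbb{Z}\cup\{\theta\})^m$, $m\ge1$: $$\mathcal{H}_n[\mathbf{s};\mathbf{t};\mathbf{r}]=\sum_{n\ge k_1>\cdots>k_m\ge1}\frac{\binom{n}{k_1}_q}{\binom{n+k_1}{k_1}_q}\prod_{j=1}^m\frac{\operatorname{sgn}(s_j)^{k_j}q^{t_jk_j+Q(r_j,k_j)}(1+q^{k_j})}{[k_j]^{|s_j|}}.$$ Merging notation: the set $\{x_1\circ\cdots\circ x_N;y_1\circ\cdots\circ y_N;z_1\circ\cdots\circ z_N\}$ (three strings of the same length $N$) consists of the triples obtained from all $2^{N-1}$ choices, for each of the $N-1$ gaps, of a comma or a merge (same choice in all three strings); each maximal run of merged entries becomes one entry: its $\oplus$-sum in the first string, ordinary sum in the second, $\boxplus$-combination in the third; sums over such a set run over all $2^{N-1}$ choices. $x^{\circ k}$ means $k$ copies of $x$ separated by $\circ$ (empty if $k=0$, with the adjoining $\circ$ dr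opped).
   Formalization: The identity is proved for rational q with 0<q<1 instead of all real q in (0,1); for fixed n and fixed indices both sides are rational functions of q, so the real case follows. -}

module Defs where

open import Data.Nat as ℕ using (ℕ; zero; suc)
open import Data.Nat.Properties as ℕP using ()
open import Data.Integer as ℤ using (ℤ; +_; -[1+_])
open import Data.Rational as ℚ using (ℚ; 0ℚ; 1ℚ; _+_; _*_; _-_; -_; 1/_; ≢-nonZero)
open import Data.Rational.Properties using (_≟_)
open import Data.List as List using (List; []; _∷_; _++_; map; concat; applyUpTo; replicate)
open import Data.Product using (_×_; _,_)
open import Data.Bool using (Bool; true; false; if_then_else_)
open import Relation.Nullary using (yes; no)

_^_ : ℚ → ℕ → ℚ
x ^ zero  = 1ℚ
x ^ suc k = x * (x ^ k)

-- total inverse (x⁻¹ for x ≠ 0; only ever applied to nonzero values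
-- when 0 < q < 1)
inv : ℚ → ℚ
inv x with x ≟ 0ℚ
... | yes _  = 0ℚ
... | no x≢0 = 1/_ x {{≢-nonZero x≢0}}

_^ℤ_ : ℚ → ℤ → ℚ
x ^ℤ (+ k)     = x ^ k
x ^ℤ -[1+ k ]  = inv (x ^ suc k)

Σ₁ : ℕ → (ℕ → ℚ) → ℚ
Σ₁ zero    f = 0ℚ
Σ₁ (suc N) f = Σ₁ N f + f (suc N)

qint : ℚ → ℕ → ℚ
qint q k = (1ℚ - q ^ k) * inv (1ℚ - q)

qpoch : ℚ → ℚ → ℕ → ℚ
qpoch x q zero    = 1ℚ
qpoch x q (suc n) = qpoch x q n * (1ℚ - x * (q ^ n))

qbinom : ℚ → ℕ → ℕ → ℚ
qbinom q n k with k ℕ.≤? n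
... | yes _ = qpoch q q n * inv (qpoch q q k * qpoch q q (n ℕ.∸ k))
... | no _  = 0ℚ

data 𝔻 : Set where
  pos : ℕ → 𝔻
  bar : ℕ → 𝔻

∣_∣ᴰ : 𝔻 → ℕ
∣ pos k ∣ᴰ = k
∣ bar k ∣ᴰ = k

sgnPow : 𝔻 → ℕ → ℚ
sgnPow (pos _) k = 1ℚ
sgnPow (bar _) k = (- 1ℚ) ^ k

_⊕_ : 𝔻 → 𝔻 → 𝔻
pos a ⊕ pos b = pos (a ℕ.+ b)
pos a ⊕ bar b = bar (a ℕ.+ b)
bar a ⊕ pos b = bar (a ℕ.+ b)
bar a ⊕ bar b = pos (a ℕ.+ b)

data Rθ : Set where
  int : ℤ → Rθ
  θ   : Rθ

tri : ℕ → ℕ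
tri zero    = 0
tri (suc k) = k ℕ.+ tri k

Qf : Rθ → ℕ → ℤ
Qf (int (+ suc r)) k = (+ suc r) ℤ.* (+ tri k)
Qf (int (+ zero))  k = ℤ.- (+ k)
Qf (int -[1+ r ])  k = (-[1+ r ] ℤ.* (+ tri k)) ℤ.- (+ k)
Qf θ               k = + 0

_⊞_ : Rθ → Rθ → Rθ
θ ⊞ b = b
int a ⊞ θ = int a
int (+ 1) ⊞ int -[1+ 0 ] = θ
int -[1+ 0 ] ⊞ int (+ 1) = int (+ 0)
int a ⊞ int b = int (a ℤ.+ b)

sumWeak : ℕ → List (ℕ → ℚ) → ℚ
sumWeak N []       = 1ℚ
sumWeak N (f ∷ fs) = Σ₁ N (λ k → f k * sumWeak k fs)

sumStrict : ℕ → List (ℕ → ℚ) → ℚ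
sumStrict N []       = 1ℚ
sumStrict N (f ∷ fs) = Σ₁ N (λ k → f k * sumStrict (k ℕ.∸ 1) fs)

starTerm : ℚ → 𝔻 → ℕ → ℚ
starTerm q s k = sgnPow s k * (q ^ k) * inv (qint q k ^ ∣ s ∣ᴰ)

Hstar : ℚ → ℕ → List 𝔻 → ℚ
Hstar q n s = sumWeak n (map (starTerm q) s)

-- 𝓗_n[s; t; r], given as a list of triples (s_j, t_j, r_j), m ≥ 1

Triple : Set
Triple = 𝔻 × ℕ × Rθ

calTerm : ℚ → Triple → ℕ → ℚ
calTerm q (s , t , r) k =
  sgnPow s k * (q ^ℤ ((+ (t ℕ.* k)) ℤ.+ Qf r k)) * (1ℚ + q ^ k)
    * inv (qint q k ^ ∣ s ∣ᴰ)

ratio : ℚ → ℕ → ℕ → ℚ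
ratio q n k = qbinom q n k * inv (qbinom q (n ℕ.+ k) k)

calH : ℚ → ℕ → List Triple → ℚ
calH q n []       = 0ℚ   -- not used (m ≥ 1 always)
calH q n (x ∷ xs) =
  Σ₁ n (λ k → ratio q n k * calTerm q x k
                * sumStrict (k ℕ.∸ 1) (map (calTerm q) xs))

combine : Triple → Triple → Triple
combine (s , t , r) (s' , t' , r') = (s ⊕ s' , t ℕ.+ t' , r ⊞ r')

-- all 2^{N-1} merge patterns; runs combined left to right
mergesFrom : Triple → List Triple → List (List Triple)
mergesFrom acc []       = (acc ∷ []) ∷ []
mergesFrom acc (y ∷ ys) =
  map (acc ∷_) (mergesFrom y ys) ++ mergesFrom (combine acc y) ys

merges : List Triple → List (List Triple)
merges []       = [] ∷ []
merges (x ∷ xs) = mergesFrom x xs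

ΣΠ : ℚ → ℕ → List Triple → ℚ
ΣΠ q n xs = List.foldr _+_ 0ℚ (map (calH q n) (merges xs))

-- The index strings of Theorem 6.4
-- a, b, c : ℕ → ℕ are the sequences a_j, b_j, c_j (a 0 = a₀).

sBlock : (a b c : ℕ → ℕ) → ℕ → List 𝔻
sBlock a b c j =
  replicate (b j) (pos 2) ++ pos (c j) ∷ replicate (a j) (pos 2) ++ pos 1 ∷ []

sBlocks : ℕ → (a b c : ℕ → ℕ) → List 𝔻
sBlocks ℓ a b c = concat (applyUpTo (λ i → sBlock a b c (suc i)) ℓ)

sA : ℕ → (a b c : ℕ → ℕ) → List 𝔻
sA ℓ a b c = sBlocks ℓ a b c

sB : ℕ → (a b c : ℕ → ℕ) → List 𝔻
sB ℓ a b c = replicate (a 0) (pos 2) ++ pos 1 ∷ sBlocks ℓ a b c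

πBlock : (a b c : ℕ → ℕ) → Rθ → ℕ → List Triple
πBlock a b c r j =
  (bar (2 ℕ.* b j ℕ.+ 2) , b j ℕ.+ 1 , r)
  ∷ replicate (c j ℕ.∸ 3) (pos 1 , 0 , θ)
  ++ (bar (2 ℕ.* a j ℕ.+ 2) , a j ℕ.+ 1 , int (+ 1)) ∷ []

firstR : ℕ → Rθ
firstR zero    = int (+ 1)
firstR (suc _) = int -[1+ 0 ]

πA : ℕ → (a b c : ℕ → ℕ) → List Triple
πA ℓ a b c = concat (applyUpTo (λ i → πBlock a b c (firstR i) (suc i)) ℓ)

πB : ℕ → (a b c : ℕ → ℕ) → List Triple
πB ℓ a b c =
  (pos (2 ℕ.* a 0 ℕ.+ 1) , a 0 ℕ.+ 1 , int (+ 2))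
  ∷ concat (applyUpTo (λ i → πBlock a b c (int -[1+ 0 ]) (suc i)) ℓ)

{-# OPTIONS --safe #-}

-- Write R(n,k) for the ratio of q-binomials in 𝓗_n and F_n(g) = Σ_{k≤n} R(n,k) g(k).  Summing 𝓗_n
-- over all merge patterns gives F_n(g) with g(k) = calTerm(x,k) · Z(k), where Z is computed entry by
-- entry: the next entry either opens a new run (a sum over j < k) or multiplies into the current one.
--
-- H*_n[s] is then built by prepending one index at a time.  Since
--     R(n,k) − R(n−1,k) = R(n,k) q^{n−k} [k]² / [n]²,
-- the identity H*_n[s, ss] = F_n(g), with g = q^k h / [k]², reduces by induction on n to
--     [n]^s F_n(h) = [n]² H*_n[ss].
-- For s = 2 this is the formula for ss.  For s = 1 and s ≥ 3 it follows by Abel summation, because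
--     R(n,k) [k] q^{k(k−1)} (1+q^k)      and      [n] R(n,k) (−1)^k q^{k(k−1)/2} (1+q^k)
-- are the differences τ(k−1) − τ(k) and σ(k−1) − σ(k) of
--     τ(k) = R(n,k) q^{k²} ([n] − [k])   and   σ(k) = −(−1)^k R(n,k) q^{k(k−1)/2} ([n] − [k]).
-- Each Abel summation with σ removes one factor [n] and one entry of the string.
module Submission where

open import Defs
open import Data.Nat as ℕ using (ℕ; zero; suc; _≤_; z≤n; s≤s)
open import Data.Nat.Properties as ℕP using ()
open import Data.Integer as ℤ using (ℤ; +_; -[1+_])
open import Data.Integer.Properties as ℤP using ()
open import Data.Integer.Solver as ℤSolver using ()
open import Data.Rational using (ℚ; 0ℚ; 1ℚ; _+_; _*_; _-_; -_; _<_; ≢-nonZero; positive)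
open import Data.Rational.Properties
open import Data.Rational.Solver as ℚSolver using ()
open import Data.List using (List; []; _∷_; _++_; map; concat; applyUpTo; replicate; foldr)
open import Data.List.Properties using (++-assoc)
open import Data.Product using (_×_; _,_)
open import Data.Unit using (⊤; tt)
open import Data.Sum using (inj₁; inj₂)
open import Function using (_∘_)
open import Relation.Nullary using (Dec; yes; no; contradiction)
open import Relation.Binary.PropositionalEquality using (_≡_; _≢_; refl; sym; trans; cong; cong₂; subst; module ≡-Reasoning)
open ≡-Reasoning
open ℚSolver.+-*-Solver
open ℤSolver.+-*-Solver using () renaming (solve to solveℤ; con to conℤ; _:+_ to _:+ℤ_; _:*_ to _:*ℤ_; :-_ to :-ℤ_; _:=_ to _:=ℤ_)

-- Total inverse and integer powers over the rationals.

x*invx : ∀ {x} → x ≢ 0ℚ → x * inv x ≡ 1ℚ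
x*invx {x} x≢0 with x ≟ 0ℚ
... | yes x≡0 = contradiction x≡0 x≢0
... | no x≢0′ = *-inverseʳ x {{≢-nonZero x≢0′}}

x*y≢0 : ∀ {x y} → x ≢ 0ℚ → y ≢ 0ℚ → x * y ≢ 0ℚ
x*y≢0 {x} {y} x≢0 y≢0 xy≡0 = y≢0 (begin
  y                ≡⟨ sym (*-identityˡ y) ⟩
  1ℚ * y           ≡⟨ cong (_* y) (sym (x*invx x≢0)) ⟩
  x * inv x * y    ≡⟨ solve 3 (λ x i y → x :* i :* y := i :* (x :* y)) refl x (inv x) y ⟩
  inv x * (x * y)  ≡⟨ cong (inv x *_) xy≡0 ⟩
  inv x * 0ℚ       ≡⟨ *-zeroʳ (inv x) ⟩
  0ℚ               ∎)

inv-unique : ∀ x y → x * y ≡ 1ℚ → inv x ≡ y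
inv-unique x y xy≡1 = begin
  inv x            ≡⟨ sym (*-identityʳ (inv x)) ⟩
  inv x * 1ℚ       ≡⟨ cong (inv x *_) (sym xy≡1) ⟩
  inv x * (x * y)  ≡⟨ solve 3 (λ i x y → i :* (x :* y) := x :* i :* y) refl (inv x) x y ⟩
  x * inv x * y    ≡⟨ cong (_* y) (x*invx x≢0) ⟩
  1ℚ * y           ≡⟨ *-identityˡ y ⟩
  y                ∎
  where
  x≢0 : x ≢ 0ℚ
  x≢0 x≡0 = 1≢0 (trans (sym xy≡1) (trans (cong (_* y) x≡0) (*-zeroˡ y)))

-- The default value 0 of `inv` at 0 makes multiplicativity unconditional: if one factor is zero,
-- both sides are zero.
inv-* : ∀ x y → inv (x * y) ≡ inv x * inv y
inv-* x y = go (x ≟ 0ℚ) (y ≟ 0ℚ)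
  where
  go : Dec (x ≡ 0ℚ) → Dec (y ≡ 0ℚ) → inv (x * y) ≡ inv x * inv y
  go (yes refl) _ = trans (cong inv (*-zeroˡ y)) (sym (*-zeroˡ (inv y)))
  go (no _) (yes refl) = trans (cong inv (*-zeroʳ x)) (sym (*-zeroʳ (inv x)))
  go (no x≢0) (no y≢0) = inv-unique (x * y) (inv x * inv y) (begin
    x * y * (inv x * inv y)    ≡⟨ solve 4 (λ x y i j → x :* y :* (i :* j) := (x :* i) :* (y :* j)) refl x y (inv x) (inv y) ⟩
    (x * inv x) * (y * inv y)  ≡⟨ cong₂ _*_ (x*invx x≢0) (x*invx y≢0) ⟩
    1ℚ                         ∎)

inv-inv : ∀ {x} → x ≢ 0ℚ → inv (inv x) ≡ x
inv-inv {x} x≢0 = inv-unique (inv x) x (trans (*-comm (inv x) x) (x*invx x≢0))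

^-+ : ∀ x m n → x ^ (m ℕ.+ n) ≡ x ^ m * x ^ n
^-+ x zero    n = sym (*-identityˡ (x ^ n))
^-+ x (suc m) n = trans (cong (x *_) (^-+ x m n)) (sym (*-assoc x (x ^ m) (x ^ n)))

^≢0 : ∀ {x} → x ≢ 0ℚ → ∀ n → x ^ n ≢ 0ℚ
^≢0 x≢0 zero    ()
^≢0 x≢0 (suc n) = x*y≢0 x≢0 (^≢0 x≢0 n)

[-1]^n*[-1]^n : ∀ n → (- 1ℚ) ^ n * (- 1ℚ) ^ n ≡ 1ℚ
[-1]^n*[-1]^n zero    = refl
[-1]^n*[-1]^n (suc n) = trans
  (solve 1 (λ s → (con (- 1ℚ) :* s) :* (con (- 1ℚ) :* s) := s :* s) refl ((- 1ℚ) ^ n))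
  ([-1]^n*[-1]^n n)

^ℤ-⊖ : ∀ {x} → x ≢ 0ℚ → ∀ m n → x ^ℤ (m ℤ.⊖ n) ≡ x ^ m * inv (x ^ n)
^ℤ-⊖ {x} x≢0 m       zero    = sym (*-identityʳ (x ^ m))
^ℤ-⊖ {x} x≢0 zero    (suc n) = sym (*-identityˡ _)
^ℤ-⊖ {x} x≢0 (suc m) (suc n) = begin
  x ^ℤ (suc m ℤ.⊖ suc n)                   ≡⟨ cong (x ^ℤ_) (ℤP.[1+m]⊖[1+n]≡m⊖n m n) ⟩
  x ^ℤ (m ℤ.⊖ n)                           ≡⟨ ^ℤ-⊖ x≢0 m n ⟩
  x ^ m * inv (x ^ n)                      ≡⟨ sym (*-identityˡ _) ⟩
  1ℚ * (x ^ m * inv (x ^ n))               ≡⟨ cong (_* (x ^ m * inv (x ^ n))) (sym (x*invx x≢0)) ⟩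
  x * inv x * (x ^ m * inv (x ^ n))        ≡⟨ solve 4 (λ x i a b → x :* i :* (a :* b) := (x :* a) :* (i :* b)) refl x (inv x) (x ^ m) (inv (x ^ n)) ⟩
  x * x ^ m * (inv x * inv (x ^ n))        ≡⟨ cong (x * x ^ m *_) (sym (inv-* x (x ^ n))) ⟩
  x ^ suc m * inv (x ^ suc n)              ∎

^ℤ-+ : ∀ {x} → x ≢ 0ℚ → ∀ a b → x ^ℤ (a ℤ.+ b) ≡ x ^ℤ a * x ^ℤ b
^ℤ-+ {x} x≢0 (+ m)    (+ n)    = ^-+ x m n
^ℤ-+ {x} x≢0 (+ m)    -[1+ n ] = ^ℤ-⊖ x≢0 m (suc n)
^ℤ-+ {x} x≢0 -[1+ m ] (+ n)    = trans (^ℤ-⊖ x≢0 n (suc m)) (*-comm (x ^ n) _)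
^ℤ-+ {x} x≢0 -[1+ m ] -[1+ n ] = begin
  inv (x ^ suc (suc (m ℕ.+ n)))      ≡⟨ cong (λ l → inv (x ^ suc l)) (sym (ℕP.+-suc m n)) ⟩
  inv (x ^ (suc m ℕ.+ suc n))        ≡⟨ cong inv (^-+ x (suc m) (suc n)) ⟩
  inv (x ^ suc m * x ^ suc n)        ≡⟨ inv-* (x ^ suc m) (x ^ suc n) ⟩
  inv (x ^ suc m) * inv (x ^ suc n)  ∎

^ℤ-neg : ∀ x n → x ^ℤ (ℤ.- (+ n)) ≡ inv (x ^ n)
^ℤ-neg x zero    = refl
^ℤ-neg x (suc n) = refl

-- Finite sums, telescoping and summation by parts.

Σ₁-cong : ∀ N {f g : ℕ → ℚ} → (∀ k → suc k ≤ N → f (suc k) ≡ g (suc k)) → Σ₁ N f ≡ Σ₁ N g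
Σ₁-cong zero    h = refl
Σ₁-cong (suc N) h = cong₂ _+_ (Σ₁-cong N (λ k k<N → h k (ℕP.m≤n⇒m≤1+n k<N))) (h N ℕP.≤-refl)

Σ₁-+ : ∀ N (f g : ℕ → ℚ) → Σ₁ N (λ k → f k + g k) ≡ Σ₁ N f + Σ₁ N g
Σ₁-+ zero    f g = refl
Σ₁-+ (suc N) f g = trans (cong (_+ (f (suc N) + g (suc N))) (Σ₁-+ N f g))
  (solve 4 (λ a b c d → (a :+ b) :+ (c :+ d) := (a :+ c) :+ (b :+ d)) refl (Σ₁ N f) (Σ₁ N g) (f (suc N)) (g (suc N)))

Σ₁-*ˡ : ∀ N c (f : ℕ → ℚ) → Σ₁ N (λ k → c * f k) ≡ c * Σ₁ N f
Σ₁-*ˡ zero    c f = sym (*-zeroʳ c)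
Σ₁-*ˡ (suc N) c f = trans (cong (_+ c * f (suc N)) (Σ₁-*ˡ N c f)) (sym (*-distribˡ-+ c (Σ₁ N f) (f (suc N))))

Σ₁-0 : ∀ N → Σ₁ N (λ _ → 0ℚ) ≡ 0ℚ
Σ₁-0 zero    = refl
Σ₁-0 (suc N) = cong (_+ 0ℚ) (Σ₁-0 N)

Σ₁-telescope : ∀ N (τ : ℕ → ℚ) → Σ₁ N (λ k → τ (k ℕ.∸ 1) - τ k) ≡ τ 0 - τ N
Σ₁-telescope zero    τ = sym (+-inverseʳ (τ 0))
Σ₁-telescope (suc N) τ = trans (cong (_+ (τ N - τ (suc N))) (Σ₁-telescope N τ))
  (solve 3 (λ a b c → (a :- b) :+ (b :- c) := a :- c) refl (τ 0) (τ N) (τ (suc N)))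

-- Summation by parts, with the inner sum strictly below k to match the strict inequalities between
-- runs. The boundary term sits on the left, so that it can be discarded whenever τ vanishes at N.
Σ₁-abel : ∀ N (τ f : ℕ → ℚ) →
  Σ₁ N (λ k → (τ (k ℕ.∸ 1) - τ k) * Σ₁ (k ℕ.∸ 1) f) + τ N * Σ₁ N f ≡ Σ₁ N (λ k → τ k * f k)
Σ₁-abel zero    τ f = trans (+-identityˡ _) (*-zeroʳ (τ 0))
Σ₁-abel (suc N) τ f = trans
  (solve 5 (λ a t t′ s x → (a :+ (t :- t′) :* s) :+ t′ :* (s :+ x) := (a :+ t :* s) :+ t′ :* x) refl
    (Σ₁ N (λ k → (τ (k ℕ.∸ 1) - τ k) * Σ₁ (k ℕ.∸ 1) f)) (τ N) (τ (suc N)) (Σ₁ N f) (f (suc N)))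
  (cong (_+ τ (suc N) * f (suc N)) (Σ₁-abel N τ f))

Σ₁-abel₀ : ∀ N (τ f : ℕ → ℚ) → τ N * Σ₁ N f ≡ 0ℚ →
  Σ₁ N (λ k → (τ (k ℕ.∸ 1) - τ k) * Σ₁ (k ℕ.∸ 1) f) ≡ Σ₁ N (λ k → τ k * f k)
Σ₁-abel₀ N τ f end = trans (sym (trans (cong (λ x → S + x) end) (+-identityʳ S))) (Σ₁-abel N τ f)
  where S = Σ₁ N (λ k → (τ (k ℕ.∸ 1) - τ k) * Σ₁ (k ℕ.∸ 1) f)

-- Signs and exponents under merging.

sgnPow-⊕ : ∀ s s′ k → sgnPow (s ⊕ s′) k ≡ sgnPow s k * sgnPow s′ k
sgnPow-⊕ (pos _) (pos _) k = refl
sgnPow-⊕ (pos _) (bar _) k = sym (*-identityˡ ((- 1ℚ) ^ k))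
sgnPow-⊕ (bar _) (pos _) k = sym (*-identityʳ ((- 1ℚ) ^ k))
sgnPow-⊕ (bar _) (bar _) k = sym ([-1]^n*[-1]^n k)

∣⊕∣ : ∀ s s′ → ∣ s ⊕ s′ ∣ᴰ ≡ ∣ s ∣ᴰ ℕ.+ ∣ s′ ∣ᴰ
∣⊕∣ (pos _) (pos _) = refl
∣⊕∣ (pos _) (bar _) = refl
∣⊕∣ (bar _) (pos _) = refl
∣⊕∣ (bar _) (bar _) = refl

-- θ is a second zero exponent: `Qf` attaches an extra -k to the integer 0 but not to θ.
coef : Rθ → ℤ
coef (int z) = z
coef θ       = + 0

-- Within a run every entry after the first contributes q^{r·k(k−1)/2}, without the extra q^{−k} that
-- Q has for r ≤ 0; that factor is due only when the run starts at an entry −1.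
Compatible : Rθ → Rθ → Set
Compatible r r′ = ∀ k → Qf (r ⊞ r′) k ≡ Qf r k ℤ.+ coef r′ ℤ.* + tri k

-- The recursion branches as `mergesFrom` does, on a new run starting at r′ or the current run
-- becoming `r ⊞ r′`. Compatibility is thus demanded of every ⊞ that occurs in some merge pattern.
Mergeable : Rθ → List Triple → Set
Mergeable r []                  = ⊤
Mergeable r ((_ , _ , r′) ∷ ys) = Compatible r r′ × Mergeable r′ ys × Mergeable (r ⊞ r′) ys

ΣL : (List Triple → ℚ) → List (List Triple) → ℚ
ΣL Ψ L = foldr _+_ 0ℚ (map Ψ L)

ΣL-++ : ∀ Ψ L M → ΣL Ψ (L ++ M) ≡ ΣL Ψ L + ΣL Ψ M
ΣL-++ Ψ []       M = sym (+-identityˡ (ΣL Ψ M))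
ΣL-++ Ψ (xs ∷ L) M = trans (cong (λ x → Ψ xs + x) (ΣL-++ Ψ L M)) (sym (+-assoc (Ψ xs) (ΣL Ψ L) (ΣL Ψ M)))

2*suc : ∀ a m → 2 ℕ.* suc a ℕ.+ m ≡ 2 ℕ.+ (2 ℕ.* a ℕ.+ m)
2*suc a m = cong (λ l → suc l ℕ.+ m) (ℕP.+-suc a (a ℕ.+ 0))

-- The ⊞-values of a run that stops inside a block −1, θ, …, θ, 1 (Open) or at its final 1 (Closed).
data Open : Rθ → Set where
  open-θ  : Open θ
  open-1  : Open (int (+ 1))
  open--1 : Open (int -[1+ 0 ])

data Closed : Rθ → Set where
  closed-0 : Closed (int (+ 0))
  closed-1 : Closed (int (+ 1))
  closed-2 : Closed (int (+ 2))

open⊞θ : ∀ {r} → Open r → Compatible r θ × Open (r ⊞ θ)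
open⊞θ open-θ  = (λ _ → refl) , open-θ
open⊞θ open-1  = (λ _ → sym (ℤP.+-identityʳ _)) , open-1
open⊞θ open--1 = (λ _ → sym (ℤP.+-identityʳ _)) , open--1

-- The exceptional value (-1) ⊞ 1 = 0 fits: the quadratic parts cancel, and Q(0,k) = -k keeps the
-- linear part of Q(-1,k).
open⊞1 : ∀ {r} → Open r → Compatible r (int (+ 1)) × Closed (r ⊞ int (+ 1))
open⊞1 open-θ  = (λ _ → sym (ℤP.+-identityˡ _)) , closed-1
open⊞1 open-1  = (λ k → solveℤ 1 (λ t → conℤ (+ 2) :*ℤ t :=ℤ conℤ (+ 1) :*ℤ t :+ℤ conℤ (+ 1) :*ℤ t) refl (+ tri k)) , closed-2
open⊞1 open--1 = (λ k → solveℤ 2 (λ t k → :-ℤ k :=ℤ (conℤ -[1+ 0 ] :*ℤ t :+ℤ :-ℤ k) :+ℤ conℤ (+ 1) :*ℤ t) refl (+ tri k) (+ k)) , closed-0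

-- The exceptional value 1 ⊞ (-1) = θ is the one needed: a run that reached 1 carries no -k, so the
-- cancelled exponent has to be θ and not 0.
closed⊞-1 : ∀ {r} → Closed r → Compatible r (int -[1+ 0 ]) × Open (r ⊞ int -[1+ 0 ])
closed⊞-1 closed-0 = (λ k → ℤP.+-comm (-[1+ 0 ] ℤ.* + tri k) (ℤ.- (+ k))) , open--1
closed⊞-1 closed-1 = (λ k → solveℤ 1 (λ t → conℤ (+ 0) :=ℤ conℤ (+ 1) :*ℤ t :+ℤ conℤ -[1+ 0 ] :*ℤ t) refl (+ tri k)) , open-θ
closed⊞-1 closed-2 = (λ k → solveℤ 1 (λ t → conℤ (+ 1) :*ℤ t :=ℤ conℤ (+ 2) :*ℤ t :+ℤ conℤ -[1+ 0 ] :*ℤ t) refl (+ tri k)) , open-1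

-- However the preceding gaps are chosen, the current run has an `Open` value until the final 1 and
-- a `Closed` value after it. The finitely many values replace a case analysis over all merge
-- patterns.
open-mergeable : ∀ d s t ys → (∀ {r} → Closed r → Mergeable r ys) →
  ∀ {r} → Open r → Mergeable r (replicate d (pos 1 , 0 , θ) ++ (s , t , int (+ 1)) ∷ ys)
open-mergeable zero    s t ys m o with open⊞1 o
... | comp , c = comp , m closed-1 , m c
open-mergeable (suc d) s t ys m o with open⊞θ o
... | comp , o′ = comp , open-mergeable d s t ys m open-θ , open-mergeable d s t ys m o′

πTail : ℕ → (a b c : ℕ → ℕ) → List Triple
πTail ℓ a b c = concat (applyUpTo (λ i → πBlock a b c (int -[1+ 0 ]) (suc i)) ℓ)

-- What follows the leading triple in a string of `suc ℓ` blocks. The third entry of that triple is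
-- 1 in case (A) and -1 in case (B); the remainder is common to both.
πRest : ℕ → (a b c : ℕ → ℕ) → List Triple
πRest ℓ a b c = replicate (c 1 ℕ.∸ 3) (pos 1 , 0 , θ)
  ++ (bar (2 ℕ.* a 1 ℕ.+ 2) , a 1 ℕ.+ 1 , int (+ 1)) ∷ πTail ℓ (a ∘ suc) (b ∘ suc) (c ∘ suc)

πBlock-++ : ∀ a b c r j ys → πBlock a b c r j ++ ys ≡
  (bar (2 ℕ.* b j ℕ.+ 2) , b j ℕ.+ 1 , r) ∷ replicate (c j ℕ.∸ 3) (pos 1 , 0 , θ) ++ (bar (2 ℕ.* a j ℕ.+ 2) , a j ℕ.+ 1 , int (+ 1)) ∷ ys
πBlock-++ a b c r j ys = cong (_ ∷_) (++-assoc (replicate (c j ℕ.∸ 3) (pos 1 , 0 , θ)) _ ys)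

sBlock-++ : ∀ a b c j ss → sBlock a b c j ++ ss ≡
  replicate (b j) (pos 2) ++ pos (c j) ∷ replicate (a j) (pos 2) ++ pos 1 ∷ ss
sBlock-++ a b c j ss = trans (++-assoc (replicate (b j) (pos 2)) _ ss)
  (cong (λ l → replicate (b j) (pos 2) ++ pos (c j) ∷ l) (++-assoc (replicate (a j) (pos 2)) _ ss))

mutual
  πRest-mergeable : ∀ ℓ a b c {r} → Open r → Mergeable r (πRest ℓ a b c)
  πRest-mergeable ℓ a b c = open-mergeable (c 1 ℕ.∸ 3) _ _ _ (πTail-mergeable ℓ (a ∘ suc) (b ∘ suc) (c ∘ suc))

  πTail-mergeable : ∀ ℓ a b c {r} → Closed r → Mergeable r (πTail ℓ a b c)
  πTail-mergeable zero    a b c cl = tt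
  πTail-mergeable (suc ℓ) a b c {r} cl with closed⊞-1 cl
  ... | comp , o = subst (Mergeable r) (sym (πBlock-++ a b c (int -[1+ 0 ]) 1 (πTail ℓ (a ∘ suc) (b ∘ suc) (c ∘ suc))))
    (comp , πRest-mergeable ℓ a b c open--1 , πRest-mergeable ℓ a b c o)

module _ (q : ℚ) (0<q : 0ℚ < q) (q<1 : q < 1ℚ) where

  -- Powers of q and q-integers: nonvanishing.

  q≢0 : q ≢ 0ℚ
  q≢0 q≡0 = <⇒≢ 0<q (sym q≡0)

  0<q^ : ∀ k → 0ℚ < q ^ k
  0<q^ zero    = positive⁻¹ 1ℚ
  0<q^ (suc k) = positive⁻¹ (q * q ^ k) {{pos*pos⇒pos q {{positive 0<q}} (q ^ k) {{positive (0<q^ k)}}}}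

  q^<1 : ∀ k → q ^ suc k < 1ℚ
  q^<1 zero    = subst (_< 1ℚ) (sym (*-identityʳ q)) q<1
  q^<1 (suc k) = <-trans
    (subst (q * q ^ suc k <_) (*-identityʳ q) (*-monoʳ-<-pos q {{positive 0<q}} (q^<1 k))) q<1

  1-x≢0 : ∀ {x} → x < 1ℚ → 1ℚ - x ≢ 0ℚ
  1-x≢0 {x} x<1 e = <⇒≢ x<1 (begin
    x                  ≡⟨ sym (+-identityˡ x) ⟩
    0ℚ + x             ≡⟨ cong (_+ x) (sym e) ⟩
    1ℚ - x + x         ≡⟨ solve 1 (λ x → con 1ℚ :- x :+ x := con 1ℚ) refl x ⟩
    1ℚ                 ∎)

  ι : ℚ
  ι = inv (1ℚ - q)

  -- The suffix i marks a reciprocal. These quantities serve as atoms for the ring solver, and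
  -- relations such as `D*Di` and `X-suc` are applied between its calls.
  D Di K Ki X Xi sg : ℕ → ℚ
  D k  = qint q k
  Di k = inv (D k)
  K k  = q ^ k
  Ki k = inv (K k)
  X k  = q ^ tri k
  Xi k = inv (X k)
  sg k = (- 1ℚ) ^ k

  D≢0 : ∀ k → D (suc k) ≢ 0ℚ
  D≢0 k = x*y≢0 (1-x≢0 (q^<1 k)) ι≢0
    where
    ι≢0 : ι ≢ 0ℚ
    ι≢0 e = 1≢0 (trans (sym (x*invx (1-x≢0 q<1))) (trans (cong ((1ℚ - q) *_) e) (*-zeroʳ (1ℚ - q))))

  D*Di : ∀ k → D (suc k) * Di (suc k) ≡ 1ℚ
  D*Di k = x*invx (D≢0 k)

  K*Ki : ∀ k → K k * Ki k ≡ 1ℚ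
  K*Ki k = x*invx (^≢0 q≢0 k)

  X*Xi : ∀ k → X k * Xi k ≡ 1ℚ
  X*Xi k = x*invx (^≢0 q≢0 (tri k))

  X-suc : ∀ k → X (suc k) ≡ K k * X k
  X-suc k = ^-+ q k (tri k)

  K-∸ : ∀ {k n} → k ≤ n → K (n ℕ.∸ k) * K k ≡ K n
  K-∸ {k} {n} k≤n = trans (sym (^-+ q (n ℕ.∸ k) k)) (cong (q ^_) (ℕP.m∸n+n≡m k≤n))

  -- The ratio of q-binomials and its two recurrences.

  P iP : ℕ → ℚ
  P n  = qpoch q q n
  iP n = inv (P n)

  P≢0 : ∀ n → P n ≢ 0ℚ
  P≢0 zero    ()
  P≢0 (suc n) = x*y≢0 (P≢0 n) (1-x≢0 (q^<1 n))

  iP-suc : ∀ n → iP (suc n) * (1ℚ - K (suc n)) ≡ iP n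
  iP-suc n = begin
    iP (suc n) * u                ≡⟨ cong (_* u) (inv-* (P n) u) ⟩
    iP n * inv u * u              ≡⟨ solve 3 (λ a i u → a :* i :* u := a :* (u :* i)) refl (iP n) (inv u) u ⟩
    iP n * (u * inv u)            ≡⟨ cong (iP n *_) (x*invx (1-x≢0 (q^<1 n))) ⟩
    iP n * 1ℚ                     ≡⟨ *-identityʳ (iP n) ⟩
    iP n                          ∎
    where u = 1ℚ - K (suc n)

  R : ℕ → ℕ → ℚ
  R = ratio q

  qbinom-≤ : ∀ {n k} → k ≤ n → qbinom q n k ≡ P n * inv (P k * P (n ℕ.∸ k))
  qbinom-≤ {n} {k} k≤n with k ℕ.≤? n
  ... | yes _  = refl
  ... | no k≰n = contradiction k≤n k≰n

  -- The factor `P k` cancels between the two binomials. In the form that is left, raising k by one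
  -- changes only one factor in each of `P (n ∸ k)` and `P (n + k)`.
  R-closed : ∀ {n k} → k ≤ n → R n k ≡ P n * P n * (iP (n ℕ.∸ k) * iP (n ℕ.+ k))
  R-closed {n} {k} k≤n = begin
    R n k
      ≡⟨ cong₂ (λ x y → x * inv y) (qbinom-≤ k≤n) (qbinom-≤ (ℕP.m≤n+m k n)) ⟩
    P n * inv (P k * P (n ℕ.∸ k)) * inv (P (n ℕ.+ k) * inv (P k * P (n ℕ.+ k ℕ.∸ k)))
      ≡⟨ cong (λ m → P n * inv (P k * P (n ℕ.∸ k)) * inv (P (n ℕ.+ k) * inv (P k * P m))) (ℕP.m+n∸n≡m n k) ⟩
    P n * inv (P k * P (n ℕ.∸ k)) * inv (P (n ℕ.+ k) * inv (P k * P n))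
      ≡⟨ cong₂ (λ x y → P n * x * y) (inv-* (P k) (P (n ℕ.∸ k))) (inv-* (P (n ℕ.+ k)) (inv (P k * P n))) ⟩
    P n * (iP k * iP (n ℕ.∸ k)) * (iP (n ℕ.+ k) * inv (inv (P k * P n)))
      ≡⟨ cong (λ x → P n * (iP k * iP (n ℕ.∸ k)) * (iP (n ℕ.+ k) * x)) (inv-inv (x*y≢0 (P≢0 k) (P≢0 n))) ⟩
    P n * (iP k * iP (n ℕ.∸ k)) * (iP (n ℕ.+ k) * (P k * P n))
      ≡⟨ solve 5 (λ n k i a b → n :* (i :* a) :* (b :* (k :* n)) := (k :* i) :* (n :* n :* (a :* b))) refl
           (P n) (P k) (iP k) (iP (n ℕ.∸ k)) (iP (n ℕ.+ k)) ⟩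
    (P k * iP k) * (P n * P n * (iP (n ℕ.∸ k) * iP (n ℕ.+ k)))
      ≡⟨ cong (_* (P n * P n * (iP (n ℕ.∸ k) * iP (n ℕ.+ k)))) (x*invx (P≢0 k)) ⟩
    1ℚ * (P n * P n * (iP (n ℕ.∸ k) * iP (n ℕ.+ k)))
      ≡⟨ *-identityˡ _ ⟩
    P n * P n * (iP (n ℕ.∸ k) * iP (n ℕ.+ k)) ∎

  R-0 : ∀ n → R n 0 ≡ 1ℚ
  R-0 n = begin
    R n 0                                  ≡⟨ R-closed {n} {0} z≤n ⟩
    P n * P n * (iP n * iP (n ℕ.+ 0))      ≡⟨ cong (λ m → P n * P n * (iP n * iP m)) (ℕP.+-identityʳ n) ⟩
    P n * P n * (iP n * iP n)              ≡⟨ solve 2 (λ p i → p :* p :* (i :* i) := (p :* i) :* (p :* i)) refl (P n) (iP n) ⟩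
    (P n * iP n) * (P n * iP n)            ≡⟨ cong₂ _*_ (x*invx (P≢0 n)) (x*invx (P≢0 n)) ⟩
    1ℚ                                     ∎

  R-> : ∀ n → R n (suc n) ≡ 0ℚ
  R-> n with suc n ℕ.≤? n
  ... | yes n<n = contradiction n<n ℕP.1+n≰n
  ... | no _    = *-zeroˡ (inv (qbinom q (n ℕ.+ suc n) (suc n)))

  -- By the closed form, R(n,k) (1-q^(n+1))² = R(n+1,k) (1-q^(n+1-k)) (1-q^(n+1+k)); the factor q^k
  -- clears the truncated difference in the exponent.
  R-sucˡ : ∀ {n k} → k ≤ suc n →
    K k * ((1ℚ - K (suc n)) * (1ℚ - K (suc n)) * R n k)
      ≡ (K k - K (suc n)) * (1ℚ - K (suc n) * K k) * R (suc n) k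
  R-sucˡ {n} {k} k≤1+n with ℕP.m≤n⇒m<n∨m≡n k≤1+n
  -- At k = n+1 the left side vanishes through the default value of the binomial, the right side
  -- through `K k - K k`.
  ... | inj₂ refl = trans
        (trans (cong (λ r → K k * ((1ℚ - K k) * (1ℚ - K k) * r)) (R-> n))
               (solve 2 (λ a b → a :* (b :* con 0ℚ) := con 0ℚ) refl (K k) ((1ℚ - K k) * (1ℚ - K k))))
        (solve 3 (λ a b c → con 0ℚ := (a :- a) :* b :* c) refl (K k) (1ℚ - K k * K k) (R k k))
  ... | inj₁ (s≤s k≤n) = begin
    K k * (u * u * R n k)
      ≡⟨ cong (λ r → K k * (u * u * r)) (R-closed k≤n) ⟩
    K k * (u * u * (P n * P n * (iP a * iP b)))
      ≡⟨ cong₂ (λ x y → K k * (u * u * (P n * P n * (x * y)))) (sym (iP-suc a)) (sym (iP-suc b)) ⟩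
    K k * (u * u * (P n * P n * ((iP (suc a) * (1ℚ - K (suc a))) * (iP (suc b) * (1ℚ - K (suc b))))))
      ≡⟨ solve 7 (λ k u p x a y b → k :* (u :* u :* (p :* p :* ((x :* (con 1ℚ :- a)) :* (y :* (con 1ℚ :- b)))))
             := (k :- a :* k) :* (con 1ℚ :- b) :* ((p :* u) :* (p :* u) :* (x :* y))) refl
           (K k) u (P n) (iP (suc a)) (K (suc a)) (iP (suc b)) (K (suc b)) ⟩
    (K k - K (suc a) * K k) * (1ℚ - K (suc b)) * (P (suc n) * P (suc n) * (iP (suc a) * iP (suc b)))
      ≡⟨ cong (λ m → (K k - K m * K k) * (1ℚ - K (suc b)) * (P (suc n) * P (suc n) * (iP m * iP (suc b)))) (sym (ℕP.+-∸-assoc 1 k≤n)) ⟩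
    (K k - K (suc n ℕ.∸ k) * K k) * (1ℚ - K (suc n ℕ.+ k)) * (P (suc n) * P (suc n) * (iP (suc n ℕ.∸ k) * iP (suc n ℕ.+ k)))
      ≡⟨ cong₂ (λ x y → (K k - x) * (1ℚ - y) * (P (suc n) * P (suc n) * (iP (suc n ℕ.∸ k) * iP (suc n ℕ.+ k))))
           (K-∸ k≤1+n) (^-+ q (suc n) k) ⟩
    (K k - K (suc n)) * (1ℚ - K (suc n) * K k) * (P (suc n) * P (suc n) * (iP (suc n ℕ.∸ k) * iP (suc n ℕ.+ k)))
      ≡⟨ cong ((K k - K (suc n)) * (1ℚ - K (suc n) * K k) *_) (sym (R-closed k≤1+n)) ⟩
    (K k - K (suc n)) * (1ℚ - K (suc n) * K k) * R (suc n) k ∎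
    where
    u = 1ℚ - K (suc n)
    a = n ℕ.∸ k
    b = n ℕ.+ k

  -- This is R(n,k) (1-q^(n-k)) = R(n,k+1) (1-q^(n+k+1)), multiplied by q^k.
  R-sucʳ : ∀ {n k} → suc k ≤ n →
    R n k * (K k - K n) ≡ R n (suc k) * (1ℚ - K n * K (suc k)) * K k
  R-sucʳ {n} {k} k<n = begin
    R n k * (K k - K n)
      ≡⟨ cong₂ (λ r x → r * (K k - x)) (R-closed k≤n) (sym (K-∸ k≤n)) ⟩
    P n * P n * (iP (n ℕ.∸ k) * iP b) * (K k - K (n ℕ.∸ k) * K k)
      ≡⟨ cong (λ m → P n * P n * (iP m * iP b) * (K k - K m * K k)) (ℕP.+-∸-assoc 1 k<n) ⟩
    P n * P n * (iP (suc a) * iP b) * (K k - K (suc a) * K k)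
      ≡⟨ solve 5 (λ p x y k a → p :* p :* (x :* y) :* (k :- a :* k) := p :* p :* ((x :* (con 1ℚ :- a)) :* y) :* k) refl
           (P n) (iP (suc a)) (iP b) (K k) (K (suc a)) ⟩
    P n * P n * ((iP (suc a) * (1ℚ - K (suc a))) * iP b) * K k
      ≡⟨ cong₂ (λ x y → P n * P n * (x * y) * K k) (iP-suc a) (sym (iP-suc b)) ⟩
    P n * P n * (iP a * (iP (suc b) * (1ℚ - K (suc b)))) * K k
      ≡⟨ solve 5 (λ p x y k b → p :* p :* (x :* (y :* (con 1ℚ :- b))) :* k := p :* p :* (x :* y) :* (con 1ℚ :- b) :* k) refl
           (P n) (iP a) (iP (suc b)) (K k) (K (suc b)) ⟩
    P n * P n * (iP a * iP (suc b)) * (1ℚ - K (suc b)) * K k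
      ≡⟨ cong (λ m → P n * P n * (iP a * iP m) * (1ℚ - K m) * K k) (sym (ℕP.+-suc n k)) ⟩
    P n * P n * (iP a * iP (n ℕ.+ suc k)) * (1ℚ - K (n ℕ.+ suc k)) * K k
      ≡⟨ cong₂ (λ r x → r * (1ℚ - x) * K k) (sym (R-closed k<n)) (^-+ q n (suc k)) ⟩
    R n (suc k) * (1ℚ - K n * K (suc k)) * K k ∎
    where
    k≤n = ℕP.<⇒≤ k<n
    a = n ℕ.∸ suc k
    b = n ℕ.+ k

  -- The two telescoping kernels.

  τ : ℕ → ℕ → ℚ
  τ n k = R n k * (K k * X k * X k) * (D n - D k)

  -- Since `D n - D k` is `(K k - K n) * ι`, `R-sucʳ` brings both terms to `R n (suc k)`. With κ =
  -- `K (suc k)` and N = `K n`, what remains is 1 - Nκ - κ(κ - N) = (1 - κ)(1 + κ).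
  τ-diff : ∀ {n k} → suc k ≤ n →
    τ n k - τ n (suc k) ≡ R n (suc k) * (D (suc k) * (X (suc k) * X (suc k)) * (1ℚ + K (suc k)))
  τ-diff {n} {k} k<n = begin
    R n k * (K k * X k * X k) * (D n - D k) - τ n (suc k)
      ≡⟨ cong (_- τ n (suc k)) (solve 5 (λ r k x n i → r :* (k :* x :* x) :* ((con 1ℚ :- n) :* i :- (con 1ℚ :- k) :* i)
           := r :* (k :- n) :* (k :* x :* x :* i)) refl (R n k) (K k) (X k) (K n) ι) ⟩
    R n k * (K k - K n) * (K k * X k * X k * ι) - τ n (suc k)
      ≡⟨ cong (λ y → y * (K k * X k * X k * ι) - τ n (suc k)) (R-sucʳ k<n) ⟩
    r * (1ℚ - K n * k′) * K k * (K k * X k * X k * ι) - r * (k′ * x * x) * (D n - D (suc k))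
      ≡⟨ cong (_- r * (k′ * x * x) * (D n - D (suc k)))
           (solve 6 (λ r n k′ k x i → r :* (con 1ℚ :- n :* k′) :* k :* (k :* x :* x :* i)
             := r :* (con 1ℚ :- n :* k′) :* ((k :* x) :* (k :* x) :* i)) refl r (K n) k′ (K k) (X k) ι) ⟩
    r * (1ℚ - K n * k′) * ((K k * X k) * (K k * X k) * ι) - r * (k′ * x * x) * (D n - D (suc k))
      ≡⟨ cong (λ y → r * (1ℚ - K n * k′) * (y * y * ι) - r * (k′ * x * x) * (D n - D (suc k))) (sym (X-suc k)) ⟩
    r * (1ℚ - K n * k′) * (x * x * ι) - r * (k′ * x * x) * (D n - D (suc k))
      ≡⟨ solve 5 (λ r n k x i → r :* (con 1ℚ :- n :* k) :* (x :* x :* i)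
             :- r :* (k :* x :* x) :* ((con 1ℚ :- n) :* i :- (con 1ℚ :- k) :* i)
           := r :* ((con 1ℚ :- k) :* i :* (x :* x) :* (con 1ℚ :+ k))) refl r (K n) k′ x ι ⟩
    r * (D (suc k) * (x * x) * (1ℚ + k′)) ∎
    where
    r = R n (suc k)
    k′ = K (suc k)
    x = X (suc k)

  σ : ℕ → ℕ → ℚ
  σ n k = - (sg k * R n k * X k * (D n - D k))

  -- As for τ, but the alternating sign turns the difference into a sum: 1 - Nκ + κ - N = (1 - N)(1
  -- + κ), which yields the factor `D n`.
  σ-diff : ∀ {n k} → suc k ≤ n →
    σ n k - σ n (suc k) ≡ D n * (R n (suc k) * (sg (suc k) * X (suc k) * (1ℚ + K (suc k))))
  σ-diff {n} {k} k<n = begin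
    - (sg k * R n k * X k * (D n - D k)) - σ n (suc k)
      ≡⟨ cong (_- σ n (suc k)) (solve 6 (λ s r x n k i → :- (s :* r :* x :* ((con 1ℚ :- n) :* i :- (con 1ℚ :- k) :* i))
           := con (- 1ℚ) :* s :* (r :* (k :- n)) :* x :* i) refl (sg k) (R n k) (X k) (K n) (K k) ι) ⟩
    s * (R n k * (K k - K n)) * X k * ι - σ n (suc k)
      ≡⟨ cong (λ y → s * y * X k * ι - σ n (suc k)) (R-sucʳ k<n) ⟩
    s * (r * (1ℚ - K n * k′) * K k) * X k * ι - σ n (suc k)
      ≡⟨ cong (_- σ n (suc k)) (solve 7 (λ s r n k′ k x i → s :* (r :* (con 1ℚ :- n :* k′) :* k) :* x :* i
           := s :* (r :* (con 1ℚ :- n :* k′)) :* (k :* x) :* i) refl s r (K n) k′ (K k) (X k) ι) ⟩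
    s * (r * (1ℚ - K n * k′)) * (K k * X k) * ι - σ n (suc k)
      ≡⟨ cong (λ y → s * (r * (1ℚ - K n * k′)) * y * ι - σ n (suc k)) (sym (X-suc k)) ⟩
    s * (r * (1ℚ - K n * k′)) * x * ι - σ n (suc k)
      ≡⟨ solve 6 (λ s r n k x i → s :* (r :* (con 1ℚ :- n :* k)) :* x :* i
             :- :- (s :* r :* x :* ((con 1ℚ :- n) :* i :- (con 1ℚ :- k) :* i))
           := (con 1ℚ :- n) :* i :* (r :* (s :* x :* (con 1ℚ :+ k)))) refl s r (K n) k′ x ι ⟩
    D n * (r * (s * x * (1ℚ + k′))) ∎
    where
    r = R n (suc k)
    k′ = K (suc k)
    x = X (suc k)
    s = sg (suc k)

  τ-diag : ∀ n y → τ n n * y ≡ 0ℚ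
  τ-diag n y = solve 3 (λ r d y → r :* (d :- d) :* y := con 0ℚ) refl (R n n * (K n * X n * X n)) (D n) y

  σ-diag : ∀ n y → σ n n * y ≡ 0ℚ
  σ-diag n y = solve 3 (λ r d y → :- (r :* (d :- d)) :* y := con 0ℚ) refl (sg n * R n n * X n) (D n) y

  -- Recurrence in n and the induction for prepending an index.

  F : ℕ → (ℕ → ℚ) → ℚ
  F n h = Σ₁ n (λ k → R n k * h k)

  ρ : ℕ → ℚ
  ρ k = K k * (Di k * Di k)

  inv-D^2 : ∀ k → inv (D k ^ 2) ≡ Di k * Di k
  inv-D^2 k = trans (inv-* (D k) (D k * 1ℚ)) (cong (λ x → Di k * inv x) (*-identityʳ (D k)))

  -- The weight `ρ` cancels the [k]² and the q^(-k) in the difference of the ratios, so the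
  -- coefficient of the last term depends on n alone and can leave the sum over k.
  R-diff : ∀ {n k} → suc k ≤ suc n →
    R (suc n) (suc k) * ρ (suc k) ≡ R n (suc k) * ρ (suc k) + K (suc n) * inv (D (suc n) ^ 2) * R (suc n) (suc k)
  R-diff {n} {k} k≤n = begin
    R′ * (κ * (d⁻ * d⁻))
      -- The factor `1ℚ * 1ℚ` is planted here to be replaced by `U * U⁻ * (U * U⁻)`, which supplies
      -- the U² required by `core`.
      ≡⟨ solve 4 (λ a b k d → a :* (k :* (d :* d)) := b :* (k :* (d :* d)) :+ k :* (con 1ℚ :* con 1ℚ :* (a :- b)) :* (d :* d)) refl R′ R₀ κ d⁻ ⟩
    R₀ * (κ * (d⁻ * d⁻)) + κ * (1ℚ * 1ℚ * (R′ - R₀)) * (d⁻ * d⁻)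
      ≡⟨ cong (λ x → R₀ * (κ * (d⁻ * d⁻)) + κ * (x * x * (R′ - R₀)) * (d⁻ * d⁻)) (sym (D*Di n)) ⟩
    R₀ * (κ * (d⁻ * d⁻)) + κ * (U * U⁻ * (U * U⁻) * (R′ - R₀)) * (d⁻ * d⁻)
      ≡⟨ solve 6 (λ a b k d u i → b :* (k :* (d :* d)) :+ k :* (u :* i :* (u :* i) :* (a :- b)) :* (d :* d)
           := b :* (k :* (d :* d)) :+ k :* (u :* u :* (a :- b)) :* (i :* i :* (d :* d))) refl R′ R₀ κ d⁻ U U⁻ ⟩
    R₀ * (κ * (d⁻ * d⁻)) + κ * (U * U * (R′ - R₀)) * (U⁻ * U⁻ * (d⁻ * d⁻))
      ≡⟨ cong (λ x → R₀ * (κ * (d⁻ * d⁻)) + x * (U⁻ * U⁻ * (d⁻ * d⁻))) core ⟩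
    R₀ * (κ * (d⁻ * d⁻)) + N * (d * d) * R′ * (U⁻ * U⁻ * (d⁻ * d⁻))
      ≡⟨ solve 7 (λ a b k d j n i → b :* (k :* (j :* j)) :+ n :* (d :* d) :* a :* (i :* i :* (j :* j))
           := b :* (k :* (j :* j)) :+ n :* (i :* i) :* a :* (d :* j :* (d :* j))) refl R′ R₀ κ d d⁻ N U⁻ ⟩
    R₀ * (κ * (d⁻ * d⁻)) + N * (U⁻ * U⁻) * R′ * (d * d⁻ * (d * d⁻))
      ≡⟨ cong₂ (λ x y → R₀ * (κ * (d⁻ * d⁻)) + N * y * R′ * (x * x)) (D*Di k) (sym (inv-D^2 (suc n))) ⟩
    R₀ * (κ * (d⁻ * d⁻)) + N * inv (U ^ 2) * R′ * 1ℚ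
      ≡⟨ cong (λ x → R₀ * (κ * (d⁻ * d⁻)) + x) (*-identityʳ (N * inv (U ^ 2) * R′)) ⟩
    R₀ * (κ * (d⁻ * d⁻)) + N * inv (U ^ 2) * R′ ∎
    where
    R′ = R (suc n) (suc k)
    R₀ = R n (suc k)
    κ = K (suc k)
    N = K (suc n)
    d = D (suc k)
    d⁻ = Di (suc k)
    U = D (suc n)
    U⁻ = Di (suc n)
    -- The underlying identity is κ(1 - N)² - (κ - N)(1 - Nκ) = N(1 - κ)².
    core : κ * (U * U * (R′ - R₀)) ≡ N * (d * d) * R′
    core = begin
      κ * (U * U * (R′ - R₀))
        ≡⟨ solve 5 (λ k n i a b → k :* ((con 1ℚ :- n) :* i :* ((con 1ℚ :- n) :* i) :* (a :- b))
             := i :* i :* (k :* ((con 1ℚ :- n) :* (con 1ℚ :- n)) :* a :- k :* ((con 1ℚ :- n) :* (con 1ℚ :- n) :* b))) refl κ N ι R′ R₀ ⟩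
      ι * ι * (κ * ((1ℚ - N) * (1ℚ - N)) * R′ - κ * ((1ℚ - N) * (1ℚ - N) * R₀))
        ≡⟨ cong (λ x → ι * ι * (κ * ((1ℚ - N) * (1ℚ - N)) * R′ - x)) (R-sucˡ k≤n) ⟩
      ι * ι * (κ * ((1ℚ - N) * (1ℚ - N)) * R′ - (κ - N) * (1ℚ - N * κ) * R′)
        ≡⟨ solve 4 (λ k n i a → i :* i :* (k :* ((con 1ℚ :- n) :* (con 1ℚ :- n)) :* a :- (k :- n) :* (con 1ℚ :- n :* k) :* a)
             := n :* ((con 1ℚ :- k) :* i :* ((con 1ℚ :- k) :* i)) :* a) refl κ N ι R′ ⟩
      N * (d * d) * R′ ∎

  -- Summing `R-diff` over k ≤ n+1 gives the increment; in the first part the top term drops out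
  -- because `R n (suc n)` is zero.
  F-suc : ∀ {g h : ℕ → ℚ} → (∀ k → g (suc k) ≡ ρ (suc k) * h (suc k)) →
    ∀ n → F (suc n) g ≡ F n g + K (suc n) * inv (D (suc n) ^ 2) * F (suc n) h
  F-suc {g} {h} g≡ρh n = begin
    F (suc n) g
      ≡⟨ Σ₁-cong (suc n) pointwise ⟩
    Σ₁ (suc n) (λ k → R n k * g k + c * (R (suc n) k * h k))
      ≡⟨ Σ₁-+ (suc n) (λ k → R n k * g k) (λ k → c * (R (suc n) k * h k)) ⟩
    F n g + R n (suc n) * g (suc n) + Σ₁ (suc n) (λ k → c * (R (suc n) k * h k))
      ≡⟨ cong₂ (λ x y → F n g + x * g (suc n) + y) (R-> n) (Σ₁-*ˡ (suc n) c (λ k → R (suc n) k * h k)) ⟩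
    F n g + 0ℚ * g (suc n) + c * F (suc n) h
      ≡⟨ cong (_+ c * F (suc n) h) (trans (cong (λ x → F n g + x) (*-zeroˡ (g (suc n)))) (+-identityʳ (F n g))) ⟩
    F n g + c * F (suc n) h ∎
    where
    c = K (suc n) * inv (D (suc n) ^ 2)
    pointwise : ∀ k → suc k ≤ suc n → R (suc n) (suc k) * g (suc k) ≡ R n (suc k) * g (suc k) + c * (R (suc n) (suc k) * h (suc k))
    pointwise k k≤n = begin
      R (suc n) (suc k) * g (suc k)
        ≡⟨ cong (R (suc n) (suc k) *_) (g≡ρh k) ⟩
      R (suc n) (suc k) * (ρ (suc k) * h (suc k))
        ≡⟨ sym (*-assoc (R (suc n) (suc k)) (ρ (suc k)) (h (suc k))) ⟩
      R (suc n) (suc k) * ρ (suc k) * h (suc k)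
        ≡⟨ cong (_* h (suc k)) (R-diff k≤n) ⟩
      (R n (suc k) * ρ (suc k) + c * R (suc n) (suc k)) * h (suc k)
        ≡⟨ solve 5 (λ a r c b h → (a :* r :+ c :* b) :* h := a :* (r :* h) :+ c :* (b :* h)) refl
             (R n (suc k)) (ρ (suc k)) c (R (suc n) (suc k)) (h (suc k)) ⟩
      R n (suc k) * (ρ (suc k) * h (suc k)) + c * (R (suc n) (suc k) * h (suc k))
        ≡⟨ cong (λ x → R n (suc k) * x + c * (R (suc n) (suc k) * h (suc k))) (sym (g≡ρh k)) ⟩
      R n (suc k) * g (suc k) + c * (R (suc n) (suc k) * h (suc k)) ∎

  -- Both sides are empty sums at n = 0. Their increments at n+1 are q^(n+1) times the two sides of
  -- the second hypothesis, by the definition of the star sum and by `F-suc`.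
  Hstar-∷ : ∀ s ss {g h : ℕ → ℚ} → (∀ k → g (suc k) ≡ ρ (suc k) * h (suc k)) →
    (∀ n → inv (D (suc n) ^ s) * Hstar q (suc n) ss ≡ inv (D (suc n) ^ 2) * F (suc n) h) →
    ∀ n → Hstar q n (pos s ∷ ss) ≡ F n g
  Hstar-∷ s ss g≡ρh step zero    = refl
  Hstar-∷ s ss {g} {h} g≡ρh step (suc n) = begin
    Hstar q n (pos s ∷ ss) + 1ℚ * K (suc n) * inv (D (suc n) ^ s) * Hstar q (suc n) ss
      ≡⟨ cong₂ _+_ (Hstar-∷ s ss g≡ρh step n)
           (solve 3 (λ k i y → con 1ℚ :* k :* i :* y := k :* (i :* y)) refl (K (suc n)) (inv (D (suc n) ^ s)) (Hstar q (suc n) ss)) ⟩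
    F n g + K (suc n) * (inv (D (suc n) ^ s) * Hstar q (suc n) ss)
      ≡⟨ cong (λ x → F n g + K (suc n) * x) (step n) ⟩
    F n g + K (suc n) * (inv (D (suc n) ^ 2) * F (suc n) h)
      ≡⟨ cong (λ x → F n g + x) (sym (*-assoc (K (suc n)) (inv (D (suc n) ^ 2)) (F (suc n) h))) ⟩
    F n g + K (suc n) * inv (D (suc n) ^ 2) * F (suc n) h
      ≡⟨ sym (F-suc g≡ρh n) ⟩
    F (suc n) g ∎

  -- Weights of runs and summation over all merge patterns.

  base : 𝔻 → ℕ → ℕ → ℚ
  base s t k = sgnPow s k * q ^ (t ℕ.* k) * inv (D k ^ ∣ s ∣ᴰ)

  -- The contribution of an entry merged into an existing run: the factor 1 + q^k occurs once per
  -- run and stays with its first entry.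
  w : Triple → ℕ → ℚ
  w (s , t , r) k = base s t k * q ^ℤ (coef r ℤ.* + tri k)

  calTerm-base : ∀ s t r k → calTerm q (s , t , r) k ≡ base s t k * q ^ℤ Qf r k * (1ℚ + K k)
  calTerm-base s t r k = trans
    (cong (λ x → sgnPow s k * x * (1ℚ + K k) * inv (D k ^ ∣ s ∣ᴰ)) (^ℤ-+ q≢0 (+ (t ℕ.* k)) (Qf r k)))
    (solve 5 (λ a b c d e → a :* (b :* c) :* d :* e := a :* b :* e :* c :* d) refl
      (sgnPow s k) (q ^ (t ℕ.* k)) (q ^ℤ Qf r k) (1ℚ + K k) (inv (D k ^ ∣ s ∣ᴰ)))

  base-⊕ : ∀ s s′ t t′ k → base (s ⊕ s′) (t ℕ.+ t′) k ≡ base s t k * base s′ t′ k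
  base-⊕ s s′ t t′ k = begin
    sgnPow (s ⊕ s′) k * q ^ ((t ℕ.+ t′) ℕ.* k) * inv (D k ^ ∣ s ⊕ s′ ∣ᴰ)
      ≡⟨ cong₂ (λ x y → x * y * inv (D k ^ ∣ s ⊕ s′ ∣ᴰ)) (sgnPow-⊕ s s′ k)
           (trans (cong (q ^_) (ℕP.*-distribʳ-+ k t t′)) (^-+ q (t ℕ.* k) (t′ ℕ.* k))) ⟩
    a * a′ * (b * b′) * inv (D k ^ ∣ s ⊕ s′ ∣ᴰ)
      ≡⟨ cong (a * a′ * (b * b′) *_)
           (trans (cong inv (trans (cong (D k ^_) (∣⊕∣ s s′)) (^-+ (D k) ∣ s ∣ᴰ ∣ s′ ∣ᴰ))) (inv-* (D k ^ ∣ s ∣ᴰ) (D k ^ ∣ s′ ∣ᴰ))) ⟩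
    a * a′ * (b * b′) * (c * c′)
      ≡⟨ solve 6 (λ a a′ b b′ c c′ → a :* a′ :* (b :* b′) :* (c :* c′) := a :* b :* c :* (a′ :* b′ :* c′)) refl a a′ b b′ c c′ ⟩
    a * b * c * (a′ * b′ * c′) ∎
    where
    a = sgnPow s k
    a′ = sgnPow s′ k
    b = q ^ (t ℕ.* k)
    b′ = q ^ (t′ ℕ.* k)
    c = inv (D k ^ ∣ s ∣ᴰ)
    c′ = inv (D k ^ ∣ s′ ∣ᴰ)

  calTerm-combine : ∀ s t r s′ t′ r′ → Compatible r r′ → ∀ k →
    calTerm q (combine (s , t , r) (s′ , t′ , r′)) k ≡ calTerm q (s , t , r) k * w (s′ , t′ , r′) k
  calTerm-combine s t r s′ t′ r′ comp k = begin
    calTerm q (combine (s , t , r) (s′ , t′ , r′)) k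
      ≡⟨ calTerm-base (s ⊕ s′) (t ℕ.+ t′) (r ⊞ r′) k ⟩
    base (s ⊕ s′) (t ℕ.+ t′) k * q ^ℤ Qf (r ⊞ r′) k * (1ℚ + K k)
      ≡⟨ cong₂ (λ x y → x * y * (1ℚ + K k)) (base-⊕ s s′ t t′ k)
           (trans (cong (q ^ℤ_) (comp k)) (^ℤ-+ q≢0 (Qf r k) (coef r′ ℤ.* + tri k))) ⟩
    b * b′ * (x * x′) * (1ℚ + K k)
      ≡⟨ solve 5 (λ b b′ x x′ o → b :* b′ :* (x :* x′) :* o := b :* x :* o :* (b′ :* x′)) refl b b′ x x′ (1ℚ + K k) ⟩
    b * x * (1ℚ + K k) * (b′ * x′)
      ≡⟨ cong (_* (b′ * x′)) (sym (calTerm-base s t r k)) ⟩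
    calTerm q (s , t , r) k * w (s′ , t′ , r′) k ∎
    where
    b = base s t k
    b′ = base s′ t′ k
    x = q ^ℤ Qf r k
    x′ = q ^ℤ (coef r′ ℤ.* + tri k)

  -- Total weight of the entries behind a run with summation index k, over all merge patterns. It
  -- depends on the run only through k, which permits recursion along the list.
  Z : List Triple → ℕ → ℚ
  Z []       k = 1ℚ
  Z (y ∷ ys) k = Σ₁ (k ℕ.∸ 1) (λ j → calTerm q y j * Z ys j) + w y k * Z ys k

  strict : ℕ → List Triple → ℚ
  strict N xs = sumStrict N (map (calTerm q) xs)

  ΣL-map-∷ : ∀ Ψ N (c : ℕ → ℚ) x → (∀ xs → Ψ (x ∷ xs) ≡ Σ₁ N (λ k → c k * calTerm q x k * strict (k ℕ.∸ 1) xs)) →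
    ∀ L → ΣL Ψ (map (x ∷_) L) ≡ Σ₁ N (λ k → c k * calTerm q x k * ΣL (strict (k ℕ.∸ 1)) L)
  ΣL-map-∷ Ψ N c x Ψ-∷ [] = sym (trans (Σ₁-cong N (λ k _ → *-zeroʳ (c (suc k) * calTerm q x (suc k)))) (Σ₁-0 N))
  ΣL-map-∷ Ψ N c x Ψ-∷ (xs ∷ L) = begin
    Ψ (x ∷ xs) + ΣL Ψ (map (x ∷_) L)
      ≡⟨ cong₂ _+_ (Ψ-∷ xs) (ΣL-map-∷ Ψ N c x Ψ-∷ L) ⟩
    Σ₁ N (λ k → c k * calTerm q x k * strict (k ℕ.∸ 1) xs) + Σ₁ N (λ k → c k * calTerm q x k * ΣL (strict (k ℕ.∸ 1)) L)
      ≡⟨ sym (Σ₁-+ N (λ k → c k * calTerm q x k * strict (k ℕ.∸ 1) xs) (λ k → c k * calTerm q x k * ΣL (strict (k ℕ.∸ 1)) L)) ⟩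
    Σ₁ N (λ k → c k * calTerm q x k * strict (k ℕ.∸ 1) xs + c k * calTerm q x k * ΣL (strict (k ℕ.∸ 1)) L)
      ≡⟨ Σ₁-cong N (λ k _ → sym (*-distribˡ-+ (c (suc k) * calTerm q x (suc k)) (strict k xs) (ΣL (strict k) L))) ⟩
    Σ₁ N (λ k → c k * calTerm q x k * ΣL (strict (k ℕ.∸ 1)) (xs ∷ L)) ∎

  -- The functional Ψ and coefficient c are kept general because the outermost sum carries the ratio
  -- `R n` while the inner strict sums carry 1; the induction needs both.
  ΣL-merges : ∀ s t r ys → Mergeable r ys → ∀ Ψ N (c : ℕ → ℚ) →
    (∀ x xs → Ψ (x ∷ xs) ≡ Σ₁ N (λ k → c k * calTerm q x k * strict (k ℕ.∸ 1) xs)) →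
    ΣL Ψ (mergesFrom (s , t , r) ys) ≡ Σ₁ N (λ k → c k * calTerm q (s , t , r) k * Z ys k)
  ΣL-merges s t r [] _ Ψ N c Ψ-∷ = trans (+-identityʳ (Ψ ((s , t , r) ∷ []))) (Ψ-∷ (s , t , r) [])
  ΣL-merges s t r (y@(s′ , t′ , r′) ∷ ys) (comp , m , m′) Ψ N c Ψ-∷ = begin
    ΣL Ψ (map (x ∷_) (mergesFrom y ys) ++ mergesFrom (combine x y) ys)
      ≡⟨ ΣL-++ Ψ (map (x ∷_) (mergesFrom y ys)) (mergesFrom (combine x y) ys) ⟩
    ΣL Ψ (map (x ∷_) (mergesFrom y ys)) + ΣL Ψ (mergesFrom (combine x y) ys)
      ≡⟨ cong₂ _+_ (ΣL-map-∷ Ψ N c x (Ψ-∷ x) (mergesFrom y ys)) (ΣL-merges (s ⊕ s′) (t ℕ.+ t′) (r ⊞ r′) ys m′ Ψ N c Ψ-∷) ⟩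
    Σ₁ N (λ k → c k * calTerm q x k * ΣL (strict (k ℕ.∸ 1)) (mergesFrom y ys)) + Σ₁ N (λ k → c k * calTerm q (combine x y) k * Z ys k)
      ≡⟨ sym (Σ₁-+ N (λ k → c k * calTerm q x k * ΣL (strict (k ℕ.∸ 1)) (mergesFrom y ys)) (λ k → c k * calTerm q (combine x y) k * Z ys k)) ⟩
    Σ₁ N (λ k → c k * calTerm q x k * ΣL (strict (k ℕ.∸ 1)) (mergesFrom y ys) + c k * calTerm q (combine x y) k * Z ys k)
      ≡⟨ Σ₁-cong N (λ k _ → pointwise (suc k)) ⟩
    Σ₁ N (λ k → c k * calTerm q x k * Z (y ∷ ys) k) ∎
    where
    x = (s , t , r)
    -- The patterns that open a new run at y: the induction hypothesis with Ψ = `strict M` and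
    -- constant coefficient 1.
    tail : ∀ M → ΣL (strict M) (mergesFrom y ys) ≡ Σ₁ M (λ j → calTerm q y j * Z ys j)
    tail M = trans
      (ΣL-merges s′ t′ r′ ys m (strict M) M (λ _ → 1ℚ) (λ z zs → Σ₁-cong M (λ j _ → cong (_* strict j zs) (sym (*-identityˡ (calTerm q z (suc j)))))))
      (Σ₁-cong M (λ j _ → cong (_* Z ys (suc j)) (*-identityˡ (calTerm q y (suc j)))))
    pointwise : ∀ k → c k * calTerm q x k * ΣL (strict (k ℕ.∸ 1)) (mergesFrom y ys) + c k * calTerm q (combine x y) k * Z ys k
      ≡ c k * calTerm q x k * Z (y ∷ ys) k
    pointwise k = trans
      (cong₂ (λ a b → c k * calTerm q x k * a + c k * b * Z ys k) (tail (k ℕ.∸ 1)) (calTerm-combine s t r s′ t′ r′ comp k))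
      (solve 5 (λ c x a w z → c :* x :* a :+ c :* (x :* w) :* z := c :* x :* (a :+ w :* z)) refl
        (c k) (calTerm q x k) (Σ₁ (k ℕ.∸ 1) (λ j → calTerm q y j * Z ys j)) (w y k) (Z ys k))

  ΣΠ-F : ∀ s t r ys → Mergeable r ys → ∀ n → ΣΠ q n ((s , t , r) ∷ ys) ≡ F n (λ k → calTerm q (s , t , r) k * Z ys k)
  ΣΠ-F s t r ys m n = trans
    (ΣL-merges s t r ys m (calH q n) n (R n) (λ _ _ → refl))
    (Σ₁-cong n (λ k _ → *-assoc (R n (suc k)) (calTerm q (s , t , r) (suc k)) (Z ys (suc k))))

  -- Explicit terms for the third entries that occur.

  q^tri : ∀ k → q ^ℤ (+ 1 ℤ.* + tri k) ≡ X k
  q^tri k = cong (q ^ℤ_) (ℤP.*-identityˡ (+ tri k))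

  q^-tri : ∀ k → q ^ℤ (-[1+ 0 ] ℤ.* + tri k) ≡ Xi k
  q^-tri k = trans (cong (q ^ℤ_) (ℤP.-1*i≡-i (+ tri k))) (^ℤ-neg q (tri k))

  calTerm-θ : ∀ s t k → calTerm q (s , t , θ) k ≡ base s t k * (1ℚ + K k)
  calTerm-θ s t k = trans (calTerm-base s t θ k) (cong (_* (1ℚ + K k)) (*-identityʳ (base s t k)))

  calTerm-1 : ∀ s t k → calTerm q (s , t , int (+ 1)) k ≡ base s t k * X k * (1ℚ + K k)
  calTerm-1 s t k = trans (calTerm-base s t (int (+ 1)) k) (cong (λ x → base s t k * x * (1ℚ + K k)) (q^tri k))

  calTerm-2 : ∀ s t k → calTerm q (s , t , int (+ 2)) k ≡ base s t k * (X k * X k) * (1ℚ + K k)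
  calTerm-2 s t k = trans (calTerm-base s t (int (+ 2)) k) (cong (λ x → base s t k * x * (1ℚ + K k))
    (trans (trans (cong (q ^ℤ_) (sym (ℤP.pos-* 2 (tri k)))) (^-+ q (tri k) (tri k ℕ.+ 0))) (cong (λ m → X k * q ^ m) (ℕP.+-identityʳ (tri k)))))

  calTerm--1 : ∀ s t k → calTerm q (s , t , int -[1+ 0 ]) k ≡ base s t k * (Xi k * Ki k) * (1ℚ + K k)
  calTerm--1 s t k = trans (calTerm-base s t (int -[1+ 0 ]) k) (cong (λ x → base s t k * x * (1ℚ + K k))
    (trans (^ℤ-+ q≢0 (-[1+ 0 ] ℤ.* + tri k) (ℤ.- (+ k))) (cong₂ _*_ (q^-tri k) (^ℤ-neg q k))))

  -- Prepending twos.

  base-two : ∀ s t k → base (pos 2 ⊕ s) (suc t) k ≡ ρ k * base s t k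
  base-two s t k = trans (base-⊕ (pos 2) s 1 t k) (cong (_* base s t k)
    (trans (cong₂ (λ m i → 1ℚ * q ^ m * i) (ℕP.*-identityˡ k) (inv-D^2 k))
           (cong (_* (Di k * Di k)) (*-identityˡ (K k)))))

  calTerm-two : ∀ s t r k → calTerm q (pos 2 ⊕ s , suc t , r) k ≡ ρ k * calTerm q (s , t , r) k
  calTerm-two s t r k = begin
    calTerm q (pos 2 ⊕ s , suc t , r) k
      ≡⟨ calTerm-base (pos 2 ⊕ s) (suc t) r k ⟩
    base (pos 2 ⊕ s) (suc t) k * x * (1ℚ + K k)
      ≡⟨ cong (λ b → b * x * (1ℚ + K k)) (base-two s t k) ⟩
    ρ k * base s t k * x * (1ℚ + K k)
      ≡⟨ solve 4 (λ r b x o → r :* b :* x :* o := r :* (b :* x :* o)) refl (ρ k) (base s t k) x (1ℚ + K k) ⟩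
    ρ k * (base s t k * x * (1ℚ + K k))
      ≡⟨ cong (ρ k *_) (sym (calTerm-base s t r k)) ⟩
    ρ k * calTerm q (s , t , r) k ∎
    where x = q ^ℤ Qf r k

  -- For index 2 the increment condition of `Hstar-∷` is the formula for the shorter string. Each 2
  -- only multiplies the leading term by `ρ`. The family s covers both the barred and the unbarred
  -- leading entries.
  Hstar-twos : (s : ℕ → 𝔻) (r : Rθ) → (∀ a → s (suc a) ≡ pos 2 ⊕ s a) → ∀ ss (z : ℕ → ℚ) →
    (∀ n → Hstar q n ss ≡ F n (λ k → calTerm q (s 0 , 1 , r) k * z k)) →
    ∀ a n → Hstar q n (replicate a (pos 2) ++ ss) ≡ F n (λ k → calTerm q (s a , a ℕ.+ 1 , r) k * z k)
  Hstar-twos s r s-suc ss z H zero    = H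
  Hstar-twos s r s-suc ss z H (suc a) = Hstar-∷ 2 (replicate a (pos 2) ++ ss) {h = λ k → calTerm q (s a , a ℕ.+ 1 , r) k * z k}
    (λ k → trans
      (cong (_* z (suc k)) (trans (cong (λ s′ → calTerm q (s′ , suc a ℕ.+ 1 , r) (suc k)) (s-suc a)) (calTerm-two (s a) (a ℕ.+ 1) r (suc k))))
      (*-assoc (ρ (suc k)) (calTerm q (s a , a ℕ.+ 1 , r) (suc k)) (z (suc k))))
    (λ n → cong (inv (D (suc n) ^ 2) *_) (Hstar-twos s r s-suc ss z H a (suc n)))

  -- Prepending a one: Abel summation with τ.

  -- Once `ρ` is split off, the factor left is the one produced by `τ-diff`.
  calTerm-112 : ∀ k y → calTerm q (pos 1 , 1 , int (+ 2)) (suc k) * y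
    ≡ ρ (suc k) * (D (suc k) * (X (suc k) * X (suc k)) * (1ℚ + K (suc k)) * y)
  calTerm-112 k′ y = begin
    calTerm q (pos 1 , 1 , int (+ 2)) k * y
      ≡⟨ cong (_* y) (calTerm-2 (pos 1) 1 k) ⟩
    1ℚ * q ^ (1 ℕ.* k) * inv (D k * 1ℚ) * (X k * X k) * (1ℚ + K k) * y
      ≡⟨ cong₂ (λ m d → 1ℚ * q ^ m * inv d * (X k * X k) * (1ℚ + K k) * y) (ℕP.*-identityˡ k) (*-identityʳ (D k)) ⟩
    1ℚ * K k * Di k * (X k * X k) * (1ℚ + K k) * y
      ≡⟨ solve 4 (λ κ i x y → con 1ℚ :* κ :* i :* (x :* x) :* (con 1ℚ :+ κ) :* y := κ :* i :* con 1ℚ :* ((x :* x) :* (con 1ℚ :+ κ) :* y)) refl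
           (K k) (Di k) (X k) y ⟩
    K k * Di k * 1ℚ * ((X k * X k) * (1ℚ + K k) * y)
      ≡⟨ cong (λ e → K k * Di k * e * ((X k * X k) * (1ℚ + K k) * y)) (sym (D*Di k′)) ⟩
    K k * Di k * (D k * Di k) * ((X k * X k) * (1ℚ + K k) * y)
      ≡⟨ solve 5 (λ κ i d x y → κ :* i :* (d :* i) :* ((x :* x) :* (con 1ℚ :+ κ) :* y) := κ :* (i :* i) :* (d :* (x :* x) :* (con 1ℚ :+ κ) :* y)) refl
           (K k) (Di k) (D k) (X k) y ⟩
    ρ k * (D k * (X k * X k) * (1ℚ + K k) * y) ∎
    where k = suc k′

  one-step : ∀ n {f h} → f ≡ D (suc n) * h → inv (D (suc n) ^ 1) * h ≡ inv (D (suc n) ^ 2) * f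
  one-step n {f} {h} f≡Dh = begin
    inv (D (suc n) * 1ℚ) * h                       ≡⟨ cong (λ d → inv d * h) (*-identityʳ (D (suc n))) ⟩
    Di (suc n) * h                                 ≡⟨ solve 2 (λ i h → i :* h := i :* con 1ℚ :* h) refl (Di (suc n)) h ⟩
    Di (suc n) * 1ℚ * h                            ≡⟨ cong (λ e → Di (suc n) * e * h) (sym (D*Di n)) ⟩
    Di (suc n) * (D (suc n) * Di (suc n)) * h      ≡⟨ solve 3 (λ i d h → i :* (d :* i) :* h := i :* i :* (d :* h)) refl (Di (suc n)) (D (suc n)) h ⟩
    Di (suc n) * Di (suc n) * (D (suc n) * h)      ≡⟨ cong₂ _*_ (sym (inv-D^2 (suc n))) (sym f≡Dh) ⟩
    inv (D (suc n) ^ 2) * f                        ∎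

  Hstar-1 : ∀ n → Hstar q n (pos 1 ∷ []) ≡ F n (λ k → calTerm q (pos 1 , 1 , int (+ 2)) k * Z [] k)
  Hstar-1 = Hstar-∷ 1 [] {h = h} (λ k → calTerm-112 k 1ℚ) (λ n → one-step n (F-h (suc n)))
    where
    h : ℕ → ℚ
    h k = D k * (X k * X k) * (1ℚ + K k) * 1ℚ
    F-h : ∀ n → F n h ≡ D n * 1ℚ
    F-h n = begin
      F n h
        ≡⟨ Σ₁-cong n (λ k k<n → trans (cong (R n (suc k) *_) (*-identityʳ _)) (sym (τ-diff k<n))) ⟩
      Σ₁ n (λ k → τ n (k ℕ.∸ 1) - τ n k)
        ≡⟨ Σ₁-telescope n (τ n) ⟩
      -- This is `τ n 0` with `K 0` and `X 0` evaluated to 1 and `D 0` unfolded; since [0] = 0, it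
      -- equals [n].
      R n 0 * 1ℚ * (D n - (1ℚ - 1ℚ) * ι) - τ n n
        ≡⟨ cong₂ (λ r t → r * 1ℚ * (D n - (1ℚ - 1ℚ) * ι) - t) (R-0 n) (trans (sym (*-identityʳ (τ n n))) (τ-diag n 1ℚ)) ⟩
      1ℚ * 1ℚ * (D n - (1ℚ - 1ℚ) * ι) - 0ℚ
        ≡⟨ solve 2 (λ d i → con 1ℚ :* con 1ℚ :* (d :- (con 1ℚ :- con 1ℚ) :* i) :- con 0ℚ := d :* con 1ℚ) refl (D n) ι ⟩
      D n * 1ℚ ∎

  -- Abel summation with τ absorbs the leading triple (1;1;2) and changes the third entry of the
  -- next triple from -1 back to 1, at the cost of a factor [n].
  Hstar-1∷ : ∀ ss s t ys →
    (∀ n → Hstar q n ss ≡ F n (λ k → calTerm q (s , t , int (+ 1)) k * Z ys k)) →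
    ∀ n → Hstar q n (pos 1 ∷ ss) ≡ F n (λ k → calTerm q (pos 1 , 1 , int (+ 2)) k * Z ((s , t , int -[1+ 0 ]) ∷ ys) k)
  Hstar-1∷ ss s t ys H = Hstar-∷ 1 ss {h = h} (λ k → calTerm-112 k (Z (y⁻ ∷ ys) (suc k)))
      (λ n → one-step n (trans (F-h (suc n)) (cong (D (suc n) *_) (sym (H (suc n))))))
    where
    y⁺ y⁻ : Triple
    y⁺ = (s , t , int (+ 1))
    y⁻ = (s , t , int -[1+ 0 ])
    g f h u : ℕ → ℚ
    u k = D k * (X k * X k) * (1ℚ + K k)
    g k = calTerm q y⁺ k * Z ys k
    f k = calTerm q y⁻ k * Z ys k
    h k = u k * Z (y⁻ ∷ ys) k
    -- The new-run part carries [n] - [k] and the merged part [k]. Their powers of q agree because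
    -- the q^(-k) in the term of -1 cancels the q^k in q^(k²) = q^k q^(k(k-1)), so the sum carries
    -- [n].
    pointwise : ∀ n k → τ n k * f k + R n k * (u k * (w y⁻ k * Z ys k)) ≡ D n * (R n k * g k)
    pointwise n k = begin
      τ n k * (calTerm q y⁻ k * z) + r * (u k * (w y⁻ k * z))
        ≡⟨ cong₂ (λ a b → τ n k * (a * z) + r * (u k * (b * z))) (calTerm--1 s t k) (cong (b *_) (q^-tri k)) ⟩
      τ n k * (b * (Xi k * Ki k) * (1ℚ + K k) * z) + r * (u k * (b * Xi k * z))
        ≡⟨ solve 9 (λ r κ κ⁻ x x⁻ dn d b z →
               r :* (κ :* x :* x) :* (dn :- d) :* (b :* (x⁻ :* κ⁻) :* (con 1ℚ :+ κ) :* z) :+ r :* (d :* (x :* x) :* (con 1ℚ :+ κ) :* (b :* x⁻ :* z))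
            := r :* x :* (x :* x⁻) :* (con 1ℚ :+ κ) :* b :* z :* ((κ :* κ⁻) :* (dn :- d) :+ d)) refl
            r (K k) (Ki k) (X k) (Xi k) (D n) (D k) b z ⟩
      r * X k * (X k * Xi k) * (1ℚ + K k) * b * z * ((K k * Ki k) * (D n - D k) + D k)
        ≡⟨ cong₂ (λ a c → r * X k * a * (1ℚ + K k) * b * z * (c * (D n - D k) + D k)) (X*Xi k) (K*Ki k) ⟩
      r * X k * 1ℚ * (1ℚ + K k) * b * z * (1ℚ * (D n - D k) + D k)
        ≡⟨ solve 7 (λ r x κ b z dn d → r :* x :* con 1ℚ :* (con 1ℚ :+ κ) :* b :* z :* (con 1ℚ :* (dn :- d) :+ d)
             := dn :* (r :* (b :* x :* (con 1ℚ :+ κ) :* z))) refl r (X k) (K k) b z (D n) (D k) ⟩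
      D n * (r * (b * X k * (1ℚ + K k) * z))
        ≡⟨ cong (λ a → D n * (r * (a * z))) (sym (calTerm-1 s t k)) ⟩
      D n * (r * g k) ∎
      where
      r = R n k
      b = base s t k
      z = Z ys k
    F-h : ∀ n → F n h ≡ D n * F n g
    F-h n = begin
      F n h
        ≡⟨ Σ₁-cong n (λ k k<n → trans
             (solve 4 (λ r u a b → r :* (u :* (a :+ b)) := r :* u :* a :+ r :* (u :* b)) refl
               (R n (suc k)) (u (suc k)) (Σ₁ k f) (w y⁻ (suc k) * Z ys (suc k)))
             (cong (λ x → x * Σ₁ k f + R n (suc k) * (u (suc k) * (w y⁻ (suc k) * Z ys (suc k)))) (sym (τ-diff k<n)))) ⟩
      Σ₁ n (λ k → (τ n (k ℕ.∸ 1) - τ n k) * Σ₁ (k ℕ.∸ 1) f + v k)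
        ≡⟨ Σ₁-+ n (λ k → (τ n (k ℕ.∸ 1) - τ n k) * Σ₁ (k ℕ.∸ 1) f) v ⟩
      Σ₁ n (λ k → (τ n (k ℕ.∸ 1) - τ n k) * Σ₁ (k ℕ.∸ 1) f) + Σ₁ n v
        ≡⟨ cong (_+ Σ₁ n v) (Σ₁-abel₀ n (τ n) f (τ-diag n (Σ₁ n f))) ⟩
      Σ₁ n (λ k → τ n k * f k) + Σ₁ n v
        ≡⟨ sym (Σ₁-+ n (λ k → τ n k * f k) v) ⟩
      Σ₁ n (λ k → τ n k * f k + v k)
        ≡⟨ Σ₁-cong n (λ k _ → pointwise n (suc k)) ⟩
      Σ₁ n (λ k → D n * (R n k * g k))
        ≡⟨ Σ₁-*ˡ n (D n) (λ k → R n k * g k) ⟩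
      D n * F n g ∎
      where
      v : ℕ → ℚ
      v k = R n k * (u k * (w y⁻ k * Z ys k))

  -- Prepending an index c ≥ 3: repeated Abel summation with σ.

  v : ℕ → ℚ
  v k = sg k * X k * (1ℚ + K k)

  -- The hypothesis excludes entries r ≤ 0, for which calTerm carries an extra q^{−k}.
  F-lower : ∀ x ys → (∀ k → calTerm q x k ≡ w x k * (1ℚ + K k)) → ∀ n →
    D n * F n (λ k → v k * Z (x ∷ ys) k) ≡ F n (λ k → sg k * X k * D k * calTerm q x k * Z ys k)
  F-lower x ys x-pos n = begin
    D n * F n (λ k → v k * Z (x ∷ ys) k)
      ≡⟨ sym (Σ₁-*ˡ n (D n) (λ k → R n k * (v k * Z (x ∷ ys) k))) ⟩
    Σ₁ n (λ k → D n * (R n k * (v k * Z (x ∷ ys) k)))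
      -- `Z (x ∷ ys)` splits into the new-run sum and the merged part. In the former, the
      -- coefficient `D n * (R n k * v k)` is a difference of σ, ready for summation by parts.
      ≡⟨ Σ₁-cong n (λ k k<n → trans
           (solve 5 (λ d r v a b → d :* (r :* (v :* (a :+ b))) := d :* (r :* v) :* a :+ d :* (r :* v) :* b) refl
             (D n) (R n (suc k)) (v (suc k)) (Σ₁ k f) (w x (suc k) * Z ys (suc k)))
           (cong (λ y → y * Σ₁ k f + D n * (R n (suc k) * v (suc k)) * (w x (suc k) * Z ys (suc k))) (sym (σ-diff k<n)))) ⟩
    Σ₁ n (λ k → (σ n (k ℕ.∸ 1) - σ n k) * Σ₁ (k ℕ.∸ 1) f + u k)
      ≡⟨ Σ₁-+ n (λ k → (σ n (k ℕ.∸ 1) - σ n k) * Σ₁ (k ℕ.∸ 1) f) u ⟩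
    Σ₁ n (λ k → (σ n (k ℕ.∸ 1) - σ n k) * Σ₁ (k ℕ.∸ 1) f) + Σ₁ n u
      ≡⟨ cong (_+ Σ₁ n u) (Σ₁-abel₀ n (σ n) f (σ-diag n (Σ₁ n f))) ⟩
    Σ₁ n (λ k → σ n k * f k) + Σ₁ n u
      ≡⟨ sym (Σ₁-+ n (λ k → σ n k * f k) u) ⟩
    Σ₁ n (λ k → σ n k * f k + u k)
      ≡⟨ Σ₁-cong n (λ k _ → pointwise (suc k)) ⟩
    F n (λ k → sg k * X k * D k * calTerm q x k * Z ys k) ∎
    where
    f u : ℕ → ℚ
    f k = calTerm q x k * Z ys k
    u k = D n * (R n k * v k) * (w x k * Z ys k)
    -- σ contributes -([n] - [k]) and the merged part [n]; only [k] survives.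
    pointwise : ∀ k → σ n k * f k + u k ≡ R n k * (sg k * X k * D k * calTerm q x k * Z ys k)
    pointwise k = trans
      (cong (λ c → σ n k * (c * Z ys k) + u k) (x-pos k))
      (trans
        (solve 8 (λ s r x dn d w z o → :- (s :* r :* x :* (dn :- d)) :* (w :* o :* z) :+ dn :* (r :* (s :* x :* o)) :* (w :* z)
            := r :* (s :* x :* d :* (w :* o) :* z)) refl
          (sg k) (R n k) (X k) (D n) (D k) (w x k) (Z ys k) (1ℚ + K k))
        (cong (λ c → R n k * (sg k * X k * D k * c * Z ys k)) (sym (x-pos k))))

  -- For the entry (1;0;θ) the [k] produced by `F-lower` cancels its denominator, and its factor 1 +
  -- q^k restores `v`. Each power of [n] thus removes one such entry and reproduces the same shape.
  F-lower-θ : ∀ d ys n →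
    D n ^ d * F n (λ k → v k * Z (replicate d (pos 1 , 0 , θ) ++ ys) k) ≡ F n (λ k → v k * Z ys k)
  F-lower-θ zero    ys n = *-identityˡ _
  F-lower-θ (suc d) ys n = begin
    D n * D n ^ d * F n (λ k → v k * Z (e ∷ es) k)
      ≡⟨ solve 3 (λ a b c → a :* b :* c := b :* (a :* c)) refl (D n) (D n ^ d) (F n (λ k → v k * Z (e ∷ es) k)) ⟩
    D n ^ d * (D n * F n (λ k → v k * Z (e ∷ es) k))
      ≡⟨ cong (D n ^ d *_) (F-lower e es (calTerm-base (pos 1) 0 θ) n) ⟩
    D n ^ d * F n (λ k → sg k * X k * D k * calTerm q e k * Z es k)
      ≡⟨ cong (D n ^ d *_) (Σ₁-cong n (λ k _ → cong (λ y → R n (suc k) * (y * Z es (suc k))) (D*calTerm k))) ⟩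
    D n ^ d * F n (λ k → v k * Z es k)
      ≡⟨ F-lower-θ d ys n ⟩
    F n (λ k → v k * Z ys k) ∎
    where
    e : Triple
    e = (pos 1 , 0 , θ)
    es = replicate d e ++ ys
    D*calTerm : ∀ k → sg (suc k) * X (suc k) * D (suc k) * calTerm q e (suc k) ≡ v (suc k)
    D*calTerm k′ = begin
      sg k * X k * D k * calTerm q e k
        ≡⟨ cong (sg k * X k * D k *_) (calTerm-θ (pos 1) 0 k) ⟩
      sg k * X k * D k * (1ℚ * 1ℚ * inv (D k * 1ℚ) * (1ℚ + K k))
        ≡⟨ cong (λ d → sg k * X k * D k * (1ℚ * 1ℚ * inv d * (1ℚ + K k))) (*-identityʳ (D k)) ⟩
      sg k * X k * D k * (1ℚ * 1ℚ * Di k * (1ℚ + K k))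
        ≡⟨ solve 5 (λ s x d i o → s :* x :* d :* (con 1ℚ :* con 1ℚ :* i :* o) := s :* x :* (d :* i) :* o) refl (sg k) (X k) (D k) (Di k) (1ℚ + K k) ⟩
      sg k * X k * (D k * Di k) * (1ℚ + K k)
        ≡⟨ cong (λ y → sg k * X k * y * (1ℚ + K k)) (D*Di k′) ⟩
      sg k * X k * 1ℚ * (1ℚ + K k)
        ≡⟨ cong (_* (1ℚ + K k)) (*-identityʳ (sg k * X k)) ⟩
      v k ∎
      where k = suc k′

  -- Of the 3 + d factors [n], d remove the entries θ, one more turns the barred triple into the
  -- leading triple of the formula for ss, and the last two are those of `Hstar-∷`.
  Hstar-c∷ : ∀ d a ss ys →
    (∀ n → Hstar q n ss ≡ F n (λ k → calTerm q (pos (2 ℕ.* a ℕ.+ 1) , a ℕ.+ 1 , int (+ 2)) k * Z ys k)) →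
    ∀ n → Hstar q n (pos (3 ℕ.+ d) ∷ ss) ≡
      F n (λ k → calTerm q (bar 2 , 1 , int (+ 1)) k *
        Z (replicate d (pos 1 , 0 , θ) ++ (bar (2 ℕ.* a ℕ.+ 2) , a ℕ.+ 1 , int (+ 1)) ∷ ys) k)
  Hstar-c∷ d a ss ys H = Hstar-∷ (3 ℕ.+ d) ss {h = h} weight step
    where
    x y : Triple
    x = (pos (2 ℕ.* a ℕ.+ 1) , a ℕ.+ 1 , int (+ 2))
    y = (bar (2 ℕ.* a ℕ.+ 2) , a ℕ.+ 1 , int (+ 1))
    zs : List Triple
    zs = replicate d (pos 1 , 0 , θ) ++ y ∷ ys
    h : ℕ → ℚ
    h k = v k * Z zs k
    weight : ∀ k → calTerm q (bar 2 , 1 , int (+ 1)) (suc k) * Z zs (suc k) ≡ ρ (suc k) * h (suc k)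
    weight k′ = begin
      calTerm q (bar 2 , 1 , int (+ 1)) k * Z zs k
        ≡⟨ cong (_* Z zs k) (calTerm-1 (bar 2) 1 k) ⟩
      base (bar 2) 1 k * X k * (1ℚ + K k) * Z zs k
        ≡⟨ cong (λ b → b * X k * (1ℚ + K k) * Z zs k) (base-two (bar 0) 0 k) ⟩
      ρ k * (sg k * 1ℚ * 1ℚ) * X k * (1ℚ + K k) * Z zs k
        ≡⟨ solve 5 (λ r s x o z → r :* (s :* con 1ℚ :* con 1ℚ) :* x :* o :* z := r :* (s :* x :* o :* z)) refl
             (ρ k) (sg k) (X k) (1ℚ + K k) (Z zs k) ⟩
      ρ k * (v k * Z zs k) ∎
      where k = suc k′
    -- The two signs cancel, [k] lowers the exponent 2a+2 to 2a+1, and the second factor `X` raises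
    -- the third entry from 1 to 2.
    x≡y : ∀ k → sg (suc k) * X (suc k) * D (suc k) * calTerm q y (suc k) ≡ calTerm q x (suc k)
    x≡y k′ = begin
      sg k * X k * D k * calTerm q y k
        ≡⟨ cong (sg k * X k * D k *_) (calTerm-1 (bar (2 ℕ.* a ℕ.+ 2)) (a ℕ.+ 1) k) ⟩
      sg k * X k * D k * (base (bar (2 ℕ.* a ℕ.+ 2)) (a ℕ.+ 1) k * X k * (1ℚ + K k))
        ≡⟨ cong (λ m → sg k * X k * D k * (base (bar m) (a ℕ.+ 1) k * X k * (1ℚ + K k))) (ℕP.+-suc (2 ℕ.* a) 1) ⟩
      sg k * X k * D k * (base (bar 1 ⊕ pos (2 ℕ.* a ℕ.+ 1)) (a ℕ.+ 1) k * X k * (1ℚ + K k))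
        ≡⟨ cong (λ b → sg k * X k * D k * (b * X k * (1ℚ + K k))) (base-⊕ (bar 1) (pos (2 ℕ.* a ℕ.+ 1)) 0 (a ℕ.+ 1) k) ⟩
      sg k * X k * D k * (sg k * 1ℚ * inv (D k * 1ℚ) * b * X k * (1ℚ + K k))
        ≡⟨ cong (λ e → sg k * X k * D k * (sg k * 1ℚ * inv e * b * X k * (1ℚ + K k))) (*-identityʳ (D k)) ⟩
      sg k * X k * D k * (sg k * 1ℚ * Di k * b * X k * (1ℚ + K k))
        ≡⟨ solve 6 (λ s x d i b o → s :* x :* d :* (s :* con 1ℚ :* i :* b :* x :* o) := (s :* s) :* (d :* i) :* (b :* (x :* x) :* o)) refl
             (sg k) (X k) (D k) (Di k) b (1ℚ + K k) ⟩
      sg k * sg k * (D k * Di k) * (b * (X k * X k) * (1ℚ + K k))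
        ≡⟨ cong₂ (λ s e → s * e * (b * (X k * X k) * (1ℚ + K k))) ([-1]^n*[-1]^n k) (D*Di k′) ⟩
      1ℚ * 1ℚ * (b * (X k * X k) * (1ℚ + K k))
        ≡⟨ *-identityˡ (b * (X k * X k) * (1ℚ + K k)) ⟩
      b * (X k * X k) * (1ℚ + K k)
        ≡⟨ sym (calTerm-2 (pos (2 ℕ.* a ℕ.+ 1)) (a ℕ.+ 1) k) ⟩
      calTerm q x k ∎
      where
      k = suc k′
      b = base (pos (2 ℕ.* a ℕ.+ 1)) (a ℕ.+ 1) k
    F-h : ∀ n → D n ^ suc d * F n h ≡ Hstar q n ss
    F-h n = begin
      D n * D n ^ d * F n h
        ≡⟨ *-assoc (D n) (D n ^ d) (F n h) ⟩
      D n * (D n ^ d * F n h)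
        ≡⟨ cong (D n *_) (F-lower-θ d (y ∷ ys) n) ⟩
      D n * F n (λ k → v k * Z (y ∷ ys) k)
        ≡⟨ F-lower y ys (calTerm-base (bar (2 ℕ.* a ℕ.+ 2)) (a ℕ.+ 1) (int (+ 1))) n ⟩
      F n (λ k → sg k * X k * D k * calTerm q y k * Z ys k)
        ≡⟨ Σ₁-cong n (λ k _ → cong (λ c → R n (suc k) * (c * Z ys (suc k))) (x≡y k)) ⟩
      F n (λ k → calTerm q x k * Z ys k)
        ≡⟨ sym (H n) ⟩
      Hstar q n ss ∎
    step : ∀ n → inv (D (suc n) ^ (3 ℕ.+ d)) * Hstar q (suc n) ss ≡ inv (D (suc n) ^ 2) * F (suc n) h
    step n = begin
      inv (U ^ (2 ℕ.+ suc d)) * Hstar q (suc n) ss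
        ≡⟨ cong₂ (λ e y → inv e * y) (^-+ U 2 (suc d)) (sym (F-h (suc n))) ⟩
      inv (U ^ 2 * U ^ suc d) * (U ^ suc d * F (suc n) h)
        ≡⟨ cong (_* (U ^ suc d * F (suc n) h)) (inv-* (U ^ 2) (U ^ suc d)) ⟩
      inv (U ^ 2) * inv (U ^ suc d) * (U ^ suc d * F (suc n) h)
        ≡⟨ solve 4 (λ a i u f → a :* i :* (u :* f) := a :* (u :* i :* f)) refl (inv (U ^ 2)) (inv (U ^ suc d)) (U ^ suc d) (F (suc n) h) ⟩
      inv (U ^ 2) * (U ^ suc d * inv (U ^ suc d) * F (suc n) h)
        ≡⟨ cong (λ e → inv (U ^ 2) * (e * F (suc n) h)) (x*invx (^≢0 (D≢0 n) (suc d))) ⟩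
      inv (U ^ 2) * (1ℚ * F (suc n) h)
        ≡⟨ cong (inv (U ^ 2) *_) (*-identityˡ (F (suc n) h)) ⟩
      inv (U ^ 2) * F (suc n) h ∎
      where U = D (suc n)

  -- Assembling the index strings of both cases.

  mutual
    -- Behind its first c, a string of case (A) is a string of case (B) for the shifted sequences.
    -- Behind its first 1, a nonempty rest of a case (B) string is of case (A). The two formulas
    -- therefore follow by mutual induction on the number of blocks.
    Hstar-sA : ∀ ℓ a b c → (∀ j → 3 ≤ c (suc j)) → ∀ n →
      Hstar q n (sA (suc ℓ) a b c) ≡
        F n (λ k → calTerm q (bar (2 ℕ.* b 1 ℕ.+ 2) , b 1 ℕ.+ 1 , int (+ 1)) k *
          Z (πRest ℓ a b c) k)
    Hstar-sA ℓ a b c 3≤c n = trans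
      (cong (Hstar q n) (sBlock-++ a b c 1 (sBlocks ℓ (a ∘ suc) (b ∘ suc) (c ∘ suc))))
      (Hstar-twos (λ m → bar (2 ℕ.* m ℕ.+ 2)) (int (+ 1)) (λ m → cong bar (2*suc m 2)) _ _ c-step (b 1) n)
      where
      rest = sB ℓ (a ∘ suc) (b ∘ suc) (c ∘ suc)
      c-step : ∀ n → Hstar q n (pos (c 1) ∷ rest) ≡ F n (λ k → calTerm q (bar 2 , 1 , int (+ 1)) k *
        Z (πRest ℓ a b c) k)
      c-step n = trans (cong (λ m → Hstar q n (pos m ∷ rest)) (sym (ℕP.m+[n∸m]≡n (3≤c 0))))
        (Hstar-c∷ (c 1 ℕ.∸ 3) (a 1) rest (πTail ℓ (a ∘ suc) (b ∘ suc) (c ∘ suc))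
          (Hstar-sB ℓ (a ∘ suc) (b ∘ suc) (c ∘ suc) (3≤c ∘ suc)) n)

    Hstar-sB : ∀ ℓ a b c → (∀ j → 3 ≤ c (suc j)) → ∀ n →
      Hstar q n (sB ℓ a b c) ≡ F n (λ k → calTerm q (pos (2 ℕ.* a 0 ℕ.+ 1) , a 0 ℕ.+ 1 , int (+ 2)) k * Z (πTail ℓ a b c) k)
    Hstar-sB ℓ a b c 3≤c = Hstar-twos (λ m → pos (2 ℕ.* m ℕ.+ 1)) (int (+ 2)) (λ m → cong pos (2*suc m 1)) _ _ (one ℓ) (a 0)
      where
      one : ∀ ℓ n → Hstar q n (pos 1 ∷ sBlocks ℓ a b c) ≡ F n (λ k → calTerm q (pos 1 , 1 , int (+ 2)) k * Z (πTail ℓ a b c) k)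
      one zero    = Hstar-1
      one (suc ℓ) n = trans
        (Hstar-1∷ (sBlocks (suc ℓ) a b c) (bar (2 ℕ.* b 1 ℕ.+ 2)) (b 1 ℕ.+ 1) (πRest ℓ a b c) (Hstar-sA ℓ a b c 3≤c) n)
        (cong (λ ys → F n (λ k → calTerm q (pos 1 , 1 , int (+ 2)) k * Z ys k))
          (sym (πBlock-++ a b c (int -[1+ 0 ]) 1 (πTail ℓ (a ∘ suc) (b ∘ suc) (c ∘ suc)))))

theorem6p4 : (q : ℚ) → 0ℚ < q → q < 1ℚ →
    (n : ℕ) → 1 ≤ n →
    (a b c : ℕ → ℕ) → (∀ j → 3 ≤ c (suc j)) →
    ((ℓ : ℕ) → 1 ≤ ℓ → Hstar q n (sA ℓ a b c) ≡ ΣΠ q n (πA ℓ a b c))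
    × ((ℓ : ℕ) → Hstar q n (sB ℓ a b c) ≡ ΣΠ q n (πB ℓ a b c))
theorem6p4 q 0<q q<1 n _ a b c 3≤c = caseA , caseB
  where
  caseA : (ℓ : ℕ) → 1 ≤ ℓ → Hstar q n (sA ℓ a b c) ≡ ΣΠ q n (πA ℓ a b c)
  caseA (suc ℓ) _ = trans (Hstar-sA q 0<q q<1 ℓ a b c 3≤c n) (trans
    -- In case (A) the first block opens with 1 in place of -1, which is also an admissible open
    -- value.
    (sym (ΣΠ-F q 0<q q<1 _ _ _ _ (πRest-mergeable ℓ a b c open-1) n))
    (cong (ΣΠ q n) (sym (πBlock-++ a b c (int (+ 1)) 1 (πTail ℓ (a ∘ suc) (b ∘ suc) (c ∘ suc))))))
  caseB : (ℓ : ℕ) → Hstar q n (sB ℓ a b c) ≡ ΣΠ q n (πB ℓ a b c)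
  caseB ℓ = trans (Hstar-sB q 0<q q<1 ℓ a b c 3≤c n)
    (sym (ΣΠ-F q 0<q q<1 _ _ _ _ (πTail-mergeable ℓ a b c closed-2) n))
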